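{- In IITT, if $\Gamma\vdash t=t':T$ then $\Gamma\vdash t\Longleftrightarrow_{\mathsf{tm}}t':T$.
   Context: Irrelevant Intensional Type Theory (IITT) is defined as follows. Sorts are $\mathsf{Set}_k$ ($k\in\mathbb{N}$), with $\mathsf{Axiom}=\{(\mathsf{Set}_i,\mathsf{Set}_{i+1})\}$ and $\mathsf{Rule}=\{(\mathsf{Set}_i,\mathsf{Set}_j,\mathsf{Set}_{\max(i,j)})\}$. Annotations $\star\in\{:,\div\}$ (relevant, irrelevant). Expressions: $t,u,T,U ::= s \mid (x\star U)\to^{s,s'}T \mid x \mid \lambda x\star U.\,t \mid t\star u$ (relevant/irrelevant dependent function types annotated with domain sort $s$ and codomain sort $s'$; abstractions; relevant application $t\,u$ and irrelevant application $t\div u$), modulo $\alpha$-equivalence; $[u/x]t$ is substitution. Contexts $\Gamma ::= ()\mid\Gamma.x\star T$. Resurrection $\Gamma^\oplus$ turns every $x\div T$ into $x:T$. Abbreviations: $\Gamma\vdash t\div T$ means $\Gamma^\oplus\vdash t:T$; $\Gamma\vdash t=t'\div T$ means $\Gamma\vdash t\div T$ and $\Gamma\vdash t'\div T$; $\Gamma\vdash T$ means $\Gamma\vdash T:s$ for some sort $s$; $\Gamma\vdash T=T'$ means $\Gamma\vdash T=T':s$ for some $s$. Rules: $\vdash()$; from $\vdash\Gamma$, $\Gamma\vdash T$ infer $\vdash\Gamma.x\star T$; from $\vdash\Gamma$, $(s,s')\in\mathsf{Axiom}$ infer $\Gamma\vdash s:s'$; from $\Gamma\vdash U:s_1$, $\Gamma.x\star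 U\vdash T:s_2$, $(s_1,s_2,s_3)\in\mathsf{Rule}$ infer $\Gamma\vdash(x\star U)\to^{s_1,s_2}T:s_3$; from $\vdash\Gamma$, $(x:U)\in\Gamma$ infer $\Gamma\vdash x:U$; from $\Gamma.x\star U\vdash t:T$, $\Gamma\vdash(x\star U)\to^{s,s'}T$ infer $\Gamma\vdash\lambda x\star U.t:(x\star U)\to^{s,s'}T$; from $\Gamma\vdash t:(x\star U)\to^{s,s'}T$, $\Gamma\vdash u\star U$ infer $\Gamma\vdash t\star u:[u/x]T$; from $\Gamma\vdash t:T$, $\Gamma\vdash T=T'$ infer $\Gamma\vdash t:T'$; $\beta$: from $\Gamma.x\star U\vdash t:T$, $\Gamma\vdash u\star U$ infer $\Gamma\vdash(\lambda x\star U.t)\star u=[u/x]t:[u/x]T$; $\eta$: from $\Gamma\vdash t:(x\star U)\to^{s,s'}T$ infer $\Gamma\vdash t=\lambda x\star U.(t\star x):(x\star U)\to^{s,s'}T$; reflexivity, symmetry, transitivity; congruence for function types (from $\Gamma\vdash U=U':s_1$, $\Gamma.x\star U\vdash T=T':s_2$, $(s_1,s_2,s_3)\in\mathsf{Rule}$), for abstractions (from $\Gamma\vdash U=U':s_1$, $\Gamma.x\star U\vdash T:s_2$, $\Gamma.x\star U\vdash t=t':T$ infer $\Gamma\vdash\lambda x\star U.t=\lambda x\star U'.t':(x\star U)\to^{s_1,s_2}T$), for application (from $\Gamma\vdash t=t':(x\star U)\to^{s,s'}T$ and $\Gamma\vdash u=u'\star U$ infer $\Gamma\vdash t\star u=t'\star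 u':[u/x]T$); conversion: from $\Gamma\vdash t=t':T$, $\Gamma\vdash T=T'$ infer $\Gamma\vdash t=t':T'$. Weak head normal forms $a,A ::= s\mid(x\star U)\to^{s,s'}T\mid\lambda x\star U.t\mid n$; neutrals $n,N ::= x\mid n\star u$. Weak head evaluation: $a\searrow a$ for whnf $a$; if $t\searrow f$ and $f\,@^\star u\searrow a$ then $t\star u\searrow a$; if $[u/x]t\searrow a$ then $(\lambda x\star U.t)\,@^\star u\searrow a$; $n\,@^\star u\searrow n\star u$. Algorithmic equality (mutually inductive; long arrows on whnf types): Type equality: $\Delta\vdash T\Longleftrightarrow_{\mathsf{ty}}T'$ if $T\searrow A$, $T'\searrow A'$, $\Delta\vdash A\longleftrightarrow_{\mathsf{ty}}A'$; $\Delta\vdash s\longleftrightarrow_{\mathsf{ty}}s$; $\Delta\vdash(x\star U)\to^{s,s'}T\longleftrightarrow_{\mathsf{ty}}(x\star U')\to^{s,s'}T'$ if $\Delta\vdash U\Longleftrightarrow_{\mathsf{ty}}U'$ and $\Delta.x\star U\vdash T\Longleftrightarrow_{\mathsf{ty}}T'$; $\Delta\vdash N\longleftrightarrow_{\mathsf{ty}}N'$ for neutrals if $\Delta\vdash N\Longleftrightarrow_{\mathsf{ne}}N':T$ for some $T$. Structural equality (type is output): $\Delta\vdash x\Longleftrightarrow_{\mathsf{ne}}x:T$ if $(x:T)\in\Delta$; $\Delta\vdash n\,u\Longleftrightarrow_{\mathsf{ne}}n'\,u':[u/x]T$ if $\Delta\vdash n\longleftrightarrow_{\mathsf{ne}}n':(x:U)\to^{s,s'}T$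 and $\Delta\vdash u\Longleftrightarrow_{\mathsf{tm}}u':U$; $\Delta\vdash n\div u\Longleftrightarrow_{\mathsf{ne}}n'\div u':[u/x]T$ if $\Delta\vdash n\longleftrightarrow_{\mathsf{ne}}n':(x\div U)\to^{s,s'}T$; $\Delta\vdash n\longleftrightarrow_{\mathsf{ne}}n':A$ if $\Delta\vdash n\Longleftrightarrow_{\mathsf{ne}}n':T$ and $T\searrow A$. Type-directed equality: $\Delta\vdash t\Longleftrightarrow_{\mathsf{tm}}t':T$ if $T\searrow A$ and $\Delta\vdash t\longleftrightarrow_{\mathsf{tm}}t':A$; $\Delta\vdash t\longleftrightarrow_{\mathsf{tm}}t':(x\star U)\to^{s,s'}T$ if $\Delta.x\star U\vdash t\star x\Longleftrightarrow_{\mathsf{tm}}t'\star x:T$; $\Delta\vdash T\longleftrightarrow_{\mathsf{tm}}T':s$ if $\Delta\vdash T\Longleftrightarrow_{\mathsf{ty}}T'$; $\Delta\vdash t\longleftrightarrow_{\mathsf{tm}}t':N$ for neutral $N$ if $t\searrow n$, $t'\searrow n'$, and $\Delta\vdash n\Longleftrightarrow_{\mathsf{ne}}n':T$ for some $T$. -}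

module Defs where

open import Data.Nat using (ℕ; zero; suc; _⊔_)
open import Data.Product using (Σ; _×_; _,_)

data Ann : Set where
  rel irr : Ann

-- Expressions.  Sorts are Set_k, represented by  srt k.
--   pi ⋆ i j U T   is  (x ⋆ U) →^{Set_i, Set_j} T   (T under one binder)
--   lam ⋆ U t      is  λ x ⋆ U. t                  (t under one binder)
--   app ⋆ t u      is  t ⋆ u   (app rel = t u,  app irr = t ÷ u)

data Tm : Set where
  srt : ℕ → Tm
  pi  : Ann → ℕ → ℕ → Tm → Tm → Tm
  var : ℕ → Tm
  lam : Ann → Tm → Tm → Tm
  app : Ann → Tm → Tm → Tm

liftRen : (ℕ → ℕ) → ℕ → ℕ
liftRen ρ zero    = zero
liftRen ρ (suc n) = suc (ρ n)

ren : (ℕ → ℕ) → Tm → Tm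
ren ρ (srt k)         = srt k
ren ρ (pi a i j U T)  = pi a i j (ren ρ U) (ren (liftRen ρ) T)
ren ρ (var n)         = var (ρ n)
ren ρ (lam a U t)     = lam a (ren ρ U) (ren (liftRen ρ) t)
ren ρ (app a t u)     = app a (ren ρ t) (ren ρ u)

wk : Tm → Tm
wk = ren suc

liftSub : (ℕ → Tm) → ℕ → Tm
liftSub σ zero    = var zero
liftSub σ (suc n) = wk (σ n)

sub : (ℕ → Tm) → Tm → Tm
sub σ (srt k)         = srt k
sub σ (pi a i j U T)  = pi a i j (sub σ U) (sub (liftSub σ) T)
sub σ (var n)         = σ n
sub σ (lam a U t)     = lam a (sub σ U) (sub (liftSub σ) t)
sub σ (app a t u)     = app a (sub σ t) (sub σ u)

single : Tm → ℕ → Tm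
single u zero    = u
single u (suc n) = var n

_[_] : Tm → Tm → Tm
t [ u ] = sub (single u) t

data Ctx : Set where
  ε   : Ctx
  _▸_ : Ctx → Ann × Tm → Ctx

infixl 5 _▸_

_⊕ : Ctx → Ctx
ε ⊕             = ε
(Γ ▸ (a , T)) ⊕ = (Γ ⊕) ▸ (rel , T)

-- the context in which an argument annotated ⋆ is checked:
-- Γ ⊢ u : U  for ⋆ = ':'  and  Γ ⊢ u ÷ U  (i.e. Γ⊕ ⊢ u : U)  for ⋆ = '÷'
ctxFor : Ann → Ctx → Ctx
ctxFor rel Γ = Γ
ctxFor irr Γ = Γ ⊕

data _∋_∶_ : Ctx → ℕ → Tm → Set where
  here  : ∀ {Γ U} → (Γ ▸ (rel , U)) ∋ zero ∶ wk U
  there : ∀ {Γ n U b V} → Γ ∋ n ∶ U → (Γ ▸ (b , V)) ∋ suc n ∶ wk U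

infix 4 ⊢_ _⊢_∶_ _⊢_≡_∶_ _⊢_≡_∶[_]_

mutual
  _⊢ty_ : Ctx → Tm → Set
  Γ ⊢ty T = Σ ℕ (λ k → Γ ⊢ T ∶ srt k)

  _⊢_≡ty_ : Ctx → Tm → Tm → Set
  Γ ⊢ T ≡ty T' = Σ ℕ (λ k → Γ ⊢ T ≡ T' ∶ srt k)

  data ⊢_ : Ctx → Set where
    ctx-ε : ⊢ ε
    ctx-▸ : ∀ {Γ a T} → ⊢ Γ → Γ ⊢ty T → ⊢ (Γ ▸ (a , T))

  data _⊢_∶_ : Ctx → Tm → Tm → Set where
    ty-srt : ∀ {Γ i} → ⊢ Γ → Γ ⊢ srt i ∶ srt (suc i)
    ty-pi  : ∀ {Γ a i j U T} →
             Γ ⊢ U ∶ srt i → (Γ ▸ (a , U)) ⊢ T ∶ srt j →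
             Γ ⊢ pi a i j U T ∶ srt (i ⊔ j)
    ty-var : ∀ {Γ x U} → ⊢ Γ → Γ ∋ x ∶ U → Γ ⊢ var x ∶ U
    ty-lam : ∀ {Γ a s s' U T t} →
             (Γ ▸ (a , U)) ⊢ t ∶ T → Γ ⊢ty pi a s s' U T →
             Γ ⊢ lam a U t ∶ pi a s s' U T
    ty-app : ∀ {Γ a s s' U T t u} →
             Γ ⊢ t ∶ pi a s s' U T → ctxFor a Γ ⊢ u ∶ U →
             Γ ⊢ app a t u ∶ (T [ u ])
    ty-conv : ∀ {Γ t T T'} → Γ ⊢ t ∶ T → Γ ⊢ T ≡ty T' → Γ ⊢ t ∶ T'

  data _⊢_≡_∶[_]_ : Ctx → Tm → Tm → Ann → Tm → Set where
    eq-rel : ∀ {Γ u u' U} → Γ ⊢ u ≡ u' ∶ U → Γ ⊢ u ≡ u' ∶[ rel ] U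
    eq-irr : ∀ {Γ u u' U} → (Γ ⊕) ⊢ u ∶ U → (Γ ⊕) ⊢ u' ∶ U →
             Γ ⊢ u ≡ u' ∶[ irr ] U

  data _⊢_≡_∶_ : Ctx → Tm → Tm → Tm → Set where
    eq-β     : ∀ {Γ a U T t u} →
               (Γ ▸ (a , U)) ⊢ t ∶ T → ctxFor a Γ ⊢ u ∶ U →
               Γ ⊢ app a (lam a U t) u ≡ (t [ u ]) ∶ (T [ u ])
    eq-η     : ∀ {Γ a s s' U T t} →
               Γ ⊢ t ∶ pi a s s' U T →
               Γ ⊢ t ≡ lam a U (app a (wk t) (var zero)) ∶ pi a s s' U T
    eq-refl  : ∀ {Γ t T} → Γ ⊢ t ∶ T → Γ ⊢ t ≡ t ∶ T
    eq-sym   : ∀ {Γ t t' T} → Γ ⊢ t ≡ t' ∶ T → Γ ⊢ t' ≡ t ∶ T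
    eq-trans : ∀ {Γ t t' t'' T} →
               Γ ⊢ t ≡ t' ∶ T → Γ ⊢ t' ≡ t'' ∶ T → Γ ⊢ t ≡ t'' ∶ T
    eq-pi    : ∀ {Γ a i j U U' T T'} →
               Γ ⊢ U ≡ U' ∶ srt i → (Γ ▸ (a , U)) ⊢ T ≡ T' ∶ srt j →
               Γ ⊢ pi a i j U T ≡ pi a i j U' T' ∶ srt (i ⊔ j)
    eq-lam   : ∀ {Γ a i j U U' T t t'} →
               Γ ⊢ U ≡ U' ∶ srt i → (Γ ▸ (a , U)) ⊢ T ∶ srt j →
               (Γ ▸ (a , U)) ⊢ t ≡ t' ∶ T →
               Γ ⊢ lam a U t ≡ lam a U' t' ∶ pi a i j U T
    eq-app   : ∀ {Γ a s s' U T t t' u u'} →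
               Γ ⊢ t ≡ t' ∶ pi a s s' U T → Γ ⊢ u ≡ u' ∶[ a ] U →
               Γ ⊢ app a t u ≡ app a t' u' ∶ (T [ u ])
    eq-conv  : ∀ {Γ t t' T T'} →
               Γ ⊢ t ≡ t' ∶ T → Γ ⊢ T ≡ty T' → Γ ⊢ t ≡ t' ∶ T'

data Neutral : Tm → Set where
  ne-var : ∀ {x} → Neutral (var x)
  ne-app : ∀ {a n u} → Neutral n → Neutral (app a n u)

data Whnf : Tm → Set where
  wh-srt : ∀ {k} → Whnf (srt k)
  wh-pi  : ∀ {a i j U T} → Whnf (pi a i j U T)
  wh-lam : ∀ {a U t} → Whnf (lam a U t)
  wh-ne  : ∀ {n} → Neutral n → Whnf n

infix 4 _↘_ _·[_]_↘_

mutual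
  data _↘_ : Tm → Tm → Set where
    ev-whnf : ∀ {a} → Whnf a → a ↘ a
    ev-app  : ∀ {⋆ t u f a} → t ↘ f → f ·[ ⋆ ] u ↘ a → app ⋆ t u ↘ a

  data _·[_]_↘_ : Tm → Ann → Tm → Tm → Set where
    ap-β  : ∀ {⋆ U t u a} → (t [ u ]) ↘ a → lam ⋆ U t ·[ ⋆ ] u ↘ a
    ap-ne : ∀ {⋆ n u} → Neutral n → n ·[ ⋆ ] u ↘ app ⋆ n u

infix 4 _⊢_⇔ty_ _⊢_↔ty_ _⊢_⇔ne_∶_ _⊢_↔ne_∶_ _⊢_⇔tm_∶_ _⊢_↔tm_∶_

mutual
  data _⊢_⇔ty_ : Ctx → Tm → Tm → Set where
    ty⇔ : ∀ {Δ T T' A A'} → T ↘ A → T' ↘ A' → Δ ⊢ A ↔ty A' → Δ ⊢ T ⇔ty T'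

  data _⊢_↔ty_ : Ctx → Tm → Tm → Set where
    ty↔-srt : ∀ {Δ k} → Δ ⊢ srt k ↔ty srt k
    ty↔-pi  : ∀ {Δ a s s' U U' T T'} →
              Δ ⊢ U ⇔ty U' → (Δ ▸ (a , U)) ⊢ T ⇔ty T' →
              Δ ⊢ pi a s s' U T ↔ty pi a s s' U' T'
    ty↔-ne  : ∀ {Δ N N' T} → Neutral N → Neutral N' →
              Δ ⊢ N ⇔ne N' ∶ T → Δ ⊢ N ↔ty N'

  data _⊢_⇔ne_∶_ : Ctx → Tm → Tm → Tm → Set where
    ne⇔-var     : ∀ {Δ x T} → Δ ∋ x ∶ T → Δ ⊢ var x ⇔ne var x ∶ T
    ne⇔-app-rel : ∀ {Δ n n' u u' s s' U T} →
                  Δ ⊢ n ↔ne n' ∶ pi rel s s' U T → Δ ⊢ u ⇔tm u' ∶ U →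
                  Δ ⊢ app rel n u ⇔ne app rel n' u' ∶ (T [ u ])
    ne⇔-app-irr : ∀ {Δ n n' u u' s s' U T} →
                  Δ ⊢ n ↔ne n' ∶ pi irr s s' U T →
                  Δ ⊢ app irr n u ⇔ne app irr n' u' ∶ (T [ u ])

  data _⊢_↔ne_∶_ : Ctx → Tm → Tm → Tm → Set where
    ne↔ : ∀ {Δ n n' T A} → Δ ⊢ n ⇔ne n' ∶ T → T ↘ A → Δ ⊢ n ↔ne n' ∶ A

  data _⊢_⇔tm_∶_ : Ctx → Tm → Tm → Tm → Set where
    tm⇔ : ∀ {Δ t t' T A} → T ↘ A → Δ ⊢ t ↔tm t' ∶ A → Δ ⊢ t ⇔tm t' ∶ T

  data _⊢_↔tm_∶_ : Ctx → Tm → Tm → Tm → Set where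
    tm↔-pi  : ∀ {Δ a s s' U T t t'} →
              (Δ ▸ (a , U)) ⊢ app a (wk t) (var zero) ⇔tm app a (wk t') (var zero) ∶ T →
              Δ ⊢ t ↔tm t' ∶ pi a s s' U T
    tm↔-srt : ∀ {Δ k T T'} → Δ ⊢ T ⇔ty T' → Δ ⊢ T ↔tm T' ∶ srt k
    tm↔-ne  : ∀ {Δ N t t' n n' T} → Neutral N →
              t ↘ n → t' ↘ n' → Δ ⊢ n ⇔ne n' ∶ T → Δ ⊢ t ↔tm t' ∶ N

{-# OPTIONS --safe #-}

-- Algorithmic equality never inspects the type or the context of its right-hand side, so it
-- follows once t and t' read back, each along its own type, to the same untyped η-long normal
-- form.  Readback is deterministic, hence "having a common readback" is trivially a partial
-- equivalence; this replaces the hard transitivity proof for algorithmic equality.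
--
-- That equal terms have a common readback is shown in a PER model of the universe hierarchy.
-- Free variables are parameters that carry their own type, so the model needs neither contexts
-- nor Kripke worlds.  Irrelevant arguments are interpreted by the total relation: an irrelevant
-- variable is never looked up, and readback erases irrelevant arguments, so the resurrected
-- premises are not needed.

module Submission where

open import Data.Empty using (⊥; ⊥-elim)
open import Data.Nat using (ℕ; zero; suc; _≤_; _<_; _⊔_)
open import Data.Nat.Properties
  using (_≟_; ≤∧≢⇒<; <-≤-trans; <-irrefl; n<1+n; m<n⇒m<1+n; m≤m⊔n; m≤n⊔m; ≤-pred)
open import Data.Product using (∃₂; Σ-syntax; ∃-syntax; _×_; _,_; proj₁; proj₂)
open import Data.Unit using (⊤; tt)
open import Function using (_∘_; id)
open import Level using (0ℓ)
open import Relation.Binary.Core using (Rel; _⇔_)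
open import Relation.Binary.PropositionalEquality
  using (_≗_; refl; sym; trans; cong; cong₂; subst; subst₂) renaming (_≡_ to _≐_)
open import Relation.Binary.Structures using (IsPartialEquivalence)
open import Relation.Nullary using (yes; no)

open import Defs

-- Expressions with parameters and their substitution calculus.

-- par a l A is a free variable of annotation a and type A, named by its de Bruijn level l.
-- A is closed, so renaming and substitution leave it alone.
data Exp : Set where
  srt : ℕ → Exp
  pi  : Ann → ℕ → ℕ → Exp → Exp → Exp
  var : ℕ → Exp
  par : Ann → ℕ → Exp → Exp
  lam : Ann → Exp → Exp → Exp
  app : Ann → Exp → Exp → Exp

Subst : Set
Subst = ℕ → Exp

infixr 5 _∷_
_∷_ : Exp → Subst → Subst
(u ∷ σ) zero    = u
(u ∷ σ) (suc n) = σ n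

rename : (ℕ → ℕ) → Exp → Exp
rename ρ (srt k)        = srt k
rename ρ (pi a i j U T) = pi a i j (rename ρ U) (rename (liftRen ρ) T)
rename ρ (var n)        = var (ρ n)
rename ρ (par a l A)    = par a l A
rename ρ (lam a U t)    = lam a (rename ρ U) (rename (liftRen ρ) t)
rename ρ (app a t u)    = app a (rename ρ t) (rename ρ u)

lift : Subst → Subst
lift σ = var zero ∷ rename suc ∘ σ

substitute : Subst → Exp → Exp
substitute σ (srt k)        = srt k
substitute σ (pi a i j U T) = pi a i j (substitute σ U) (substitute (lift σ) T)
substitute σ (var n)        = σ n
substitute σ (par a l A)    = par a l A
substitute σ (lam a U t)    = lam a (substitute σ U) (substitute (lift σ) t)
substitute σ (app a t u)    = app a (substitute σ t) (substitute σ u)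

_⟨_⟩ : Exp → Exp → Exp
t ⟨ u ⟩ = substitute (u ∷ var) t

-- Embedding and substitution in one pass, with `σ` in the role of a semantic environment.
inst : Subst → Tm → Exp
inst σ (srt k)        = srt k
inst σ (pi a i j U T) = pi a i j (inst σ U) (inst (lift σ) T)
inst σ (var n)        = σ n
inst σ (lam a U t)    = lam a (inst σ U) (inst (lift σ) t)
inst σ (app a t u)    = app a (inst σ t) (inst σ u)

pi-cong : ∀ {a i j} {U U' T T' : Exp} → U ≐ U' → T ≐ T' → pi a i j U T ≐ pi a i j U' T'
pi-cong refl refl = refl

lam-cong : ∀ {a} {U U' t t' : Exp} → U ≐ U' → t ≐ t' → lam a U t ≐ lam a U' t'
lam-cong refl refl = refl

app-cong : ∀ {a} {t t' u u' : Exp} → t ≐ t' → u ≐ u' → app a t u ≐ app a t' u'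
app-cong refl refl = refl

∷-cong : ∀ {u u' σ τ} → u ≐ u' → σ ≗ τ → (u ∷ σ) ≗ (u' ∷ τ)
∷-cong p q zero    = p
∷-cong p q (suc n) = q n

lift-cong : ∀ {σ τ} → σ ≗ τ → lift σ ≗ lift τ
lift-cong p = ∷-cong refl (cong (rename suc) ∘ p)

rename-cong : ∀ {ρ ρ'} → ρ ≗ ρ' → rename ρ ≗ rename ρ'
rename-cong p (srt k)        = refl
rename-cong p (pi a i j U T) = pi-cong (rename-cong p U) (rename-cong (λ { zero → refl ; (suc n) → cong suc (p n) }) T)
rename-cong p (var n)        = cong var (p n)
rename-cong p (par a l A)    = refl
rename-cong p (lam a U t)    = lam-cong (rename-cong p U) (rename-cong (λ { zero → refl ; (suc n) → cong suc (p n) }) t)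
rename-cong p (app a t u)    = app-cong (rename-cong p t) (rename-cong p u)

substitute-cong : ∀ {σ τ} → σ ≗ τ → substitute σ ≗ substitute τ
substitute-cong p (srt k)        = refl
substitute-cong p (pi a i j U T) = pi-cong (substitute-cong p U) (substitute-cong (lift-cong p) T)
substitute-cong p (var n)        = p n
substitute-cong p (par a l A)    = refl
substitute-cong p (lam a U t)    = lam-cong (substitute-cong p U) (substitute-cong (lift-cong p) t)
substitute-cong p (app a t u)    = app-cong (substitute-cong p t) (substitute-cong p u)

inst-cong : ∀ {σ τ} → σ ≗ τ → inst σ ≗ inst τ
inst-cong p (srt k)        = refl
inst-cong p (pi a i j U T) = pi-cong (inst-cong p U) (inst-cong (lift-cong p) T)
inst-cong p (var n)        = p n
inst-cong p (lam a U t)    = lam-cong (inst-cong p U) (inst-cong (lift-cong p) t)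
inst-cong p (app a t u)    = app-cong (inst-cong p t) (inst-cong p u)

rename-∘ : ∀ ρ ρ' t → rename ρ (rename ρ' t) ≐ rename (ρ ∘ ρ') t
rename-∘-lift : ∀ ρ ρ' t → rename (liftRen ρ) (rename (liftRen ρ') t) ≐ rename (liftRen (ρ ∘ ρ')) t

rename-∘ ρ ρ' (srt k)        = refl
rename-∘ ρ ρ' (pi a i j U T) = pi-cong (rename-∘ ρ ρ' U) (rename-∘-lift ρ ρ' T)
rename-∘ ρ ρ' (var n)        = refl
rename-∘ ρ ρ' (par a l A)    = refl
rename-∘ ρ ρ' (lam a U t)    = lam-cong (rename-∘ ρ ρ' U) (rename-∘-lift ρ ρ' t)
rename-∘ ρ ρ' (app a t u)    = app-cong (rename-∘ ρ ρ' t) (rename-∘ ρ ρ' u)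

rename-∘-lift ρ ρ' t = trans (rename-∘ (liftRen ρ) (liftRen ρ') t)
                             (rename-cong (λ { zero → refl ; (suc n) → refl }) t)

substitute-rename : ∀ σ ρ t → substitute σ (rename ρ t) ≐ substitute (σ ∘ ρ) t
substitute-rename-lift : ∀ σ ρ t → substitute (lift σ) (rename (liftRen ρ) t) ≐ substitute (lift (σ ∘ ρ)) t

substitute-rename σ ρ (srt k)        = refl
substitute-rename σ ρ (pi a i j U T) = pi-cong (substitute-rename σ ρ U) (substitute-rename-lift σ ρ T)
substitute-rename σ ρ (var n)        = refl
substitute-rename σ ρ (par a l A)    = refl
substitute-rename σ ρ (lam a U t)    = lam-cong (substitute-rename σ ρ U) (substitute-rename-lift σ ρ t)
substitute-rename σ ρ (app a t u)    = app-cong (substitute-rename σ ρ t) (substitute-rename σ ρ u)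

substitute-rename-lift σ ρ t = trans (substitute-rename (lift σ) (liftRen ρ) t)
                                 (substitute-cong (λ { zero → refl ; (suc n) → refl }) t)

lift-rename : ∀ ρ (σ : Subst) → rename (liftRen ρ) ∘ lift σ ≗ lift (rename ρ ∘ σ)
lift-rename ρ σ zero    = refl
lift-rename ρ σ (suc n) = trans (rename-∘ (liftRen ρ) suc (σ n)) (sym (rename-∘ suc ρ (σ n)))

rename-substitute : ∀ ρ σ t → rename ρ (substitute σ t) ≐ substitute (rename ρ ∘ σ) t
rename-substitute-lift : ∀ ρ σ t → rename (liftRen ρ) (substitute (lift σ) t) ≐ substitute (lift (rename ρ ∘ σ)) t

rename-substitute ρ σ (srt k)        = refl
rename-substitute ρ σ (pi a i j U T) = pi-cong (rename-substitute ρ σ U) (rename-substitute-lift ρ σ T)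
rename-substitute ρ σ (var n)        = refl
rename-substitute ρ σ (par a l A)    = refl
rename-substitute ρ σ (lam a U t)    = lam-cong (rename-substitute ρ σ U) (rename-substitute-lift ρ σ t)
rename-substitute ρ σ (app a t u)    = app-cong (rename-substitute ρ σ t) (rename-substitute ρ σ u)

rename-substitute-lift ρ σ t = trans (rename-substitute (liftRen ρ) (lift σ) t)
                                 (substitute-cong (lift-rename ρ σ) t)

substitute-var : ∀ {σ} → σ ≗ var → ∀ t → substitute σ t ≐ t
substitute-var-lift : ∀ {σ} → σ ≗ var → ∀ t → substitute (lift σ) t ≐ t

substitute-var p (srt k)        = refl
substitute-var p (pi a i j U T) = pi-cong (substitute-var p U) (substitute-var-lift p T)
substitute-var p (var n)        = p n
substitute-var p (par a l A)    = refl
substitute-var p (lam a U t)    = lam-cong (substitute-var p U) (substitute-var-lift p t)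
substitute-var p (app a t u)    = app-cong (substitute-var p t) (substitute-var p u)

substitute-var-lift p = substitute-var (λ { zero → refl ; (suc n) → cong (rename suc) (p n) })

inst-ren : ∀ σ ρ t → inst σ (ren ρ t) ≐ inst (σ ∘ ρ) t
inst-ren-lift : ∀ σ ρ t → inst (lift σ) (ren (liftRen ρ) t) ≐ inst (lift (σ ∘ ρ)) t

inst-ren σ ρ (srt k)        = refl
inst-ren σ ρ (pi a i j U T) = pi-cong (inst-ren σ ρ U) (inst-ren-lift σ ρ T)
inst-ren σ ρ (var n)        = refl
inst-ren σ ρ (lam a U t)    = lam-cong (inst-ren σ ρ U) (inst-ren-lift σ ρ t)
inst-ren σ ρ (app a t u)    = app-cong (inst-ren σ ρ t) (inst-ren σ ρ u)

inst-ren-lift σ ρ t = trans (inst-ren (lift σ) (liftRen ρ) t)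
                            (inst-cong (λ { zero → refl ; (suc n) → refl }) t)

rename-inst : ∀ ρ σ t → rename ρ (inst σ t) ≐ inst (rename ρ ∘ σ) t
rename-inst-lift : ∀ ρ σ t → rename (liftRen ρ) (inst (lift σ) t) ≐ inst (lift (rename ρ ∘ σ)) t

rename-inst ρ σ (srt k)        = refl
rename-inst ρ σ (pi a i j U T) = pi-cong (rename-inst ρ σ U) (rename-inst-lift ρ σ T)
rename-inst ρ σ (var n)        = refl
rename-inst ρ σ (lam a U t)    = lam-cong (rename-inst ρ σ U) (rename-inst-lift ρ σ t)
rename-inst ρ σ (app a t u)    = app-cong (rename-inst ρ σ t) (rename-inst ρ σ u)

rename-inst-lift ρ σ t = trans (rename-inst (liftRen ρ) (lift σ) t)
                               (inst-cong (lift-rename ρ σ) t)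

substitute-inst : ∀ τ σ t → substitute τ (inst σ t) ≐ inst (substitute τ ∘ σ) t
substitute-inst-lift : ∀ τ σ t → substitute (lift τ) (inst (lift σ) t) ≐ inst (lift (substitute τ ∘ σ)) t

substitute-inst τ σ (srt k)        = refl
substitute-inst τ σ (pi a i j U T) = pi-cong (substitute-inst τ σ U) (substitute-inst-lift τ σ T)
substitute-inst τ σ (var n)        = refl
substitute-inst τ σ (lam a U t)    = lam-cong (substitute-inst τ σ U) (substitute-inst-lift τ σ t)
substitute-inst τ σ (app a t u)    = app-cong (substitute-inst τ σ t) (substitute-inst τ σ u)

substitute-inst-lift τ σ t = trans (substitute-inst (lift τ) (lift σ) t) (inst-cong commute t)
  where
  commute : substitute (lift τ) ∘ lift σ ≗ lift (substitute τ ∘ σ)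
  commute zero    = refl
  commute (suc n) = trans (substitute-rename (lift τ) suc (σ n)) (sym (rename-substitute suc τ (σ n)))

inst-sub : ∀ σ τ t → inst σ (sub τ t) ≐ inst (inst σ ∘ τ) t
inst-sub-lift : ∀ σ τ t → inst (lift σ) (sub (liftSub τ) t) ≐ inst (lift (inst σ ∘ τ)) t

inst-sub σ τ (srt k)        = refl
inst-sub σ τ (pi a i j U T) = pi-cong (inst-sub σ τ U) (inst-sub-lift σ τ T)
inst-sub σ τ (var n)        = refl
inst-sub σ τ (lam a U t)    = lam-cong (inst-sub σ τ U) (inst-sub-lift σ τ t)
inst-sub σ τ (app a t u)    = app-cong (inst-sub σ τ t) (inst-sub σ τ u)

inst-sub-lift σ τ t = trans (inst-sub (lift σ) (liftSub τ) t) (inst-cong commute t)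
  where
  commute : inst (lift σ) ∘ liftSub τ ≗ lift (inst σ ∘ τ)
  commute zero    = refl
  commute (suc n) = trans (inst-ren (lift σ) suc (τ n)) (sym (rename-inst suc σ (τ n)))

inst-wk : ∀ {u σ} t → inst (u ∷ σ) (wk t) ≐ inst σ t
inst-wk {u} {σ} t = inst-ren (u ∷ σ) suc t

-- Evaluation and readback open a binder by substitution, whereas validity extends the environment;
-- this equation mediates between the two.
inst-lift-⟨⟩ : ∀ σ t u → inst (lift σ) t ⟨ u ⟩ ≐ inst (u ∷ σ) t
inst-lift-⟨⟩ σ t u = trans (substitute-inst (u ∷ var) (lift σ) t) (inst-cong commute t)
  where
  commute : substitute (u ∷ var) ∘ lift σ ≗ u ∷ σ
  commute zero    = refl
  commute (suc n) = trans (substitute-rename (u ∷ var) suc (σ n)) (substitute-var (λ _ → refl) (σ n))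

inst-[] : ∀ σ t u → inst σ (t [ u ]) ≐ inst (inst σ u ∷ σ) t
inst-[] σ t u = trans (inst-sub σ (single u) t)
                      (inst-cong (λ { zero → refl ; (suc n) → refl }) t)

inst-lift-[] : ∀ σ t u → inst (lift σ) t ⟨ inst σ u ⟩ ≐ inst σ (t [ u ])
inst-lift-[] σ t u = trans (inst-lift-⟨⟩ σ t (inst σ u)) (sym (inst-[] σ t u))

-- Weak head evaluation

-- Readback opens binders with parameters, so a bare `var` counts neither as neutral nor as weak
-- head normal.
data NeutralE : Exp → Set where
  ne-par : ∀ {a l A} → NeutralE (par a l A)
  ne-app : ∀ {a n u} → NeutralE n → NeutralE (app a n u)

data WhnfE : Exp → Set where
  wh-srt : ∀ {k} → WhnfE (srt k)
  wh-pi  : ∀ {a i j U T} → WhnfE (pi a i j U T)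
  wh-lam : ∀ {a U t} → WhnfE (lam a U t)
  wh-ne  : ∀ {n} → NeutralE n → WhnfE n

infix 4 _⇘_ _·[_]_⇘_ _≽_

mutual
  data _⇘_ : Exp → Exp → Set where
    ev-whnf : ∀ {a} → WhnfE a → a ⇘ a
    ev-app  : ∀ {⋆ t u f a} → t ⇘ f → f ·[ ⋆ ] u ⇘ a → app ⋆ t u ⇘ a

  data _·[_]_⇘_ : Exp → Ann → Exp → Exp → Set where
    ap-β  : ∀ {⋆ U t u a} → t ⟨ u ⟩ ⇘ a → lam ⋆ U t ·[ ⋆ ] u ⇘ a
    ap-ne : ∀ {⋆ n u} → NeutralE n → n ·[ ⋆ ] u ⇘ app ⋆ n u

neutral-⇘ : ∀ {n a} → NeutralE n → n ⇘ a → n ≐ a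
neutral-⇘ ne (ev-whnf w) = refl
neutral-⇘ (ne-app ne) (ev-app d e) with neutral-⇘ ne d
neutral-⇘ (ne-app ()) (ev-app d (ap-β e)) | refl
neutral-⇘ (ne-app ne) (ev-app d (ap-ne _)) | refl = refl

whnf-⇘ : ∀ {a b} → WhnfE a → a ⇘ b → a ≐ b
whnf-⇘ w (ev-whnf _) = refl
whnf-⇘ (wh-ne ne) d  = neutral-⇘ ne d

mutual
  ⇘-det : ∀ {t a b} → t ⇘ a → t ⇘ b → a ≐ b
  ⇘-det (ev-whnf w) d = whnf-⇘ w d
  ⇘-det d (ev-whnf w) = sym (whnf-⇘ w d)
  ⇘-det (ev-app d e) (ev-app d' e') with refl ← ⇘-det d d' = ·⇘-det e e'

  ·⇘-det : ∀ {f ⋆ u a b} → f ·[ ⋆ ] u ⇘ a → f ·[ ⋆ ] u ⇘ b → a ≐ b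
  ·⇘-det (ap-β d) (ap-β d')      = ⇘-det d d'
  ·⇘-det (ap-ne _) (ap-ne _)     = refl

-- Weak head expansion, phrased through evaluation alone so that no reduction relation has to be set
-- up.
_≽_ : Exp → Exp → Set
t ≽ t' = ∀ {a} → t' ⇘ a → t ⇘ a

≽-app : ∀ {a t t' u} → t ≽ t' → app a t u ≽ app a t' u
≽-app r (ev-whnf (wh-ne (ne-app ne))) = ev-app (r (ev-whnf (wh-ne ne))) (ap-ne ne)
≽-app r (ev-app d e)                  = ev-app (r d) e

≽-β : ∀ {a U t u} → app a (lam a U t) u ≽ t ⟨ u ⟩
≽-β d = ev-app (ev-whnf wh-lam) (ap-β d)

-- Readback

-- ty and ne mark whether a term was read back at a sort or at a neutral type, so that equal
-- results are reached by the same rules.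
data Nf : Set where
  srt : ℕ → Nf
  pi  : Ann → ℕ → ℕ → Nf → Nf → Nf
  ty  : Nf → Nf
  lam : Ann → Nf → Nf
  ne  : Nf → Nf
  var : ℕ → Nf
  app : Nf → Nf → Nf
  irr : Nf → Nf

infix 4 _⊢_⇓ty_ _⊢_↓ty_ _⊢_⇓ne_∶_ _⊢_⇓tm_∶_ _⊢_↓tm_∶_

-- `m` is the level given to the next parameter. Nothing here ties the levels already present in a
-- term to `m`; that they are distinct is ensured later by `Naming`.
mutual
  data _⊢_⇓ty_ (m : ℕ) : Exp → Nf → Set where
    eval-ty : ∀ {T A V} → T ⇘ A → m ⊢ A ↓ty V → m ⊢ T ⇓ty V

  data _⊢_↓ty_ (m : ℕ) : Exp → Nf → Set where
    ↓ty-srt : ∀ {k} → m ⊢ srt k ↓ty srt k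
    ↓ty-pi  : ∀ {a i j U T V W} → m ⊢ U ⇓ty V → suc m ⊢ T ⟨ par a m U ⟩ ⇓ty W →
              m ⊢ pi a i j U T ↓ty pi a i j V W
    ↓ty-ne  : ∀ {N v T} → m ⊢ N ⇓ne v ∶ T → m ⊢ N ↓ty ne v

  data _⊢_⇓ne_∶_ (m : ℕ) : Exp → Nf → Exp → Set where
    ⇓ne-par : ∀ {l A} → m ⊢ par rel l A ⇓ne var l ∶ A
    ⇓ne-rel : ∀ {n u v w A i j U T} → m ⊢ n ⇓ne v ∶ A → A ⇘ pi rel i j U T → m ⊢ u ⇓tm w ∶ U →
              m ⊢ app rel n u ⇓ne app v w ∶ T ⟨ u ⟩
    ⇓ne-irr : ∀ {n u v A i j U T} → m ⊢ n ⇓ne v ∶ A → A ⇘ pi irr i j U T →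
              m ⊢ app irr n u ⇓ne irr v ∶ T ⟨ u ⟩

  data _⊢_⇓tm_∶_ (m : ℕ) : Exp → Nf → Exp → Set where
    eval-tm : ∀ {t v T A} → T ⇘ A → m ⊢ t ↓tm v ∶ A → m ⊢ t ⇓tm v ∶ T

  data _⊢_↓tm_∶_ (m : ℕ) : Exp → Nf → Exp → Set where
    ↓tm-srt : ∀ {k T V} → m ⊢ T ⇓ty V → m ⊢ T ↓tm ty V ∶ srt k
    ↓tm-pi  : ∀ {a i j U T t v} → suc m ⊢ app a t (par a m U) ⇓tm v ∶ T ⟨ par a m U ⟩ →
              m ⊢ t ↓tm lam a v ∶ pi a i j U T
    ↓tm-ne  : ∀ {N t n v T} → NeutralE N → t ⇘ n → m ⊢ n ⇓ne v ∶ T → m ⊢ t ↓tm ne v ∶ N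

⇓ne-neutral : ∀ {m n v T} → m ⊢ n ⇓ne v ∶ T → NeutralE n
⇓ne-neutral ⇓ne-par         = ne-par
⇓ne-neutral (⇓ne-rel d _ _) = ne-app (⇓ne-neutral d)
⇓ne-neutral (⇓ne-irr d _)   = ne-app (⇓ne-neutral d)

mutual
  ⇓ty-det : ∀ {m T V V'} → m ⊢ T ⇓ty V → m ⊢ T ⇓ty V' → V ≐ V'
  ⇓ty-det (eval-ty e d) (eval-ty e' d') with refl ← ⇘-det e e' = ↓ty-det d d'

  ↓ty-det : ∀ {m T V V'} → m ⊢ T ↓ty V → m ⊢ T ↓ty V' → V ≐ V'
  ↓ty-det ↓ty-srt ↓ty-srt               = refl
  ↓ty-det (↓ty-pi c d) (↓ty-pi c' d')   = cong₂ (pi _ _ _) (⇓ty-det c c') (⇓ty-det d d')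
  ↓ty-det (↓ty-ne d) (↓ty-ne d')        = cong ne (proj₁ (⇓ne-det d d'))

  -- The type is an output, fixed by the head parameter and the arguments. Its uniqueness is proved
  -- along with that of the readback, since only then are the two readbacks of an argument taken at
  -- the same type.
  ⇓ne-det : ∀ {m n v v' T T'} → m ⊢ n ⇓ne v ∶ T → m ⊢ n ⇓ne v' ∶ T' → v ≐ v' × T ≐ T'
  ⇓ne-det ⇓ne-par ⇓ne-par = refl , refl
  ⇓ne-det (⇓ne-rel d e c) (⇓ne-rel d' e' c')
    with refl , refl ← ⇓ne-det d d'
    with refl ← ⇘-det e e'
    with refl ← ⇓tm-det c c' = refl , refl
  ⇓ne-det (⇓ne-irr d e) (⇓ne-irr d' e')
    with refl , refl ← ⇓ne-det d d'
    with refl ← ⇘-det e e' = refl , refl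

  ⇓tm-det : ∀ {m t v v' T} → m ⊢ t ⇓tm v ∶ T → m ⊢ t ⇓tm v' ∶ T → v ≐ v'
  ⇓tm-det (eval-tm e d) (eval-tm e' d') with refl ← ⇘-det e e' = ↓tm-det d d'

  ↓tm-det : ∀ {m t v v' T} → m ⊢ t ↓tm v ∶ T → m ⊢ t ↓tm v' ∶ T → v ≐ v'
  ↓tm-det (↓tm-srt d) (↓tm-srt d') = cong ty (⇓ty-det d d')
  ↓tm-det (↓tm-pi d) (↓tm-pi d')   = cong (lam _) (⇓tm-det d d')
  ↓tm-det (↓tm-ne _ e d) (↓tm-ne _ e' d') with refl ← ⇘-det e e' = cong ne (proj₁ (⇓ne-det d d'))

-- A partial equivalence model of the universe hierarchy

PER : Rel Exp 0ℓ → Set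
PER = IsPartialEquivalence

module _ {_~_ : Rel Exp 0ℓ} (per : PER _~_) where
  open IsPartialEquivalence per renaming (sym to ~-sym; trans to ~-trans)

  per-reflˡ : ∀ {t t'} → t ~ t' → t ~ t
  per-reflˡ r = ~-trans r (~-sym r)

  per-reflʳ : ∀ {t t'} → t ~ t' → t' ~ t'
  per-reflʳ r = ~-trans (~-sym r) r

  per-resp-⇔ : ∀ {_~'_ : Rel Exp 0ℓ} → _~_ ⇔ _~'_ → PER _~'_
  per-resp-⇔ (to , from) = record
    { sym   = λ r → to (~-sym (from r))
    ; trans = λ r s → to (~-trans (from r) (from s)) }

⇔-refl : {R : Rel Exp 0ℓ} → R ⇔ R
⇔-refl = id , id

⇔-sym : {R S : Rel Exp 0ℓ} → R ⇔ S → S ⇔ R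
⇔-sym (to , from) = from , to

⇔-trans : {R S T : Rel Exp 0ℓ} → R ⇔ S → S ⇔ T → R ⇔ T
⇔-trans (f , g) (h , k) = (λ r → h (f r)) , (λ r → g (k r))

Restrict : Ann → Rel Exp 0ℓ → Rel Exp 0ℓ
Restrict rel R = R
Restrict irr R = λ _ _ → ⊤

restrict-⇔ : ∀ a {R S : Rel Exp 0ℓ} → R ⇔ S → Restrict a R ⇔ Restrict a S
restrict-⇔ rel e = e
restrict-⇔ irr e = id , id

restrict-per : ∀ a {R : Rel Exp 0ℓ} → PER R → PER (Restrict a R)
restrict-per rel per = per
restrict-per irr per = record { sym = id ; trans = λ _ _ → tt }

record FunRel (a : Ann) (D : Rel Exp 0ℓ) (F : ∀ {u u'} → D u u' → Rel Exp 0ℓ) (t t' : Exp) : Set where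
  constructor fun
  field apply : ∀ {u u'} (r : D u u') → F r (app a t u) (app a t' u')

open FunRel

-- Evidence transported between `D` and `D'` can be any proof, so the families are compared at all
-- pairs `r`, `r'`.
FunRel-⇔ : ∀ {a} {D D' : Rel Exp 0ℓ} {F : ∀ {u u'} → D u u' → Rel Exp 0ℓ}
           {F' : ∀ {u u'} → D' u u' → Rel Exp 0ℓ} →
           D ⇔ D' → (∀ {u u'} (r : D u u') (r' : D' u u') → F r ⇔ F' r') →
           FunRel a D F ⇔ FunRel a D' F'
FunRel-⇔ (to , from) e =
  (λ f → fun λ r' → proj₁ (e (from r') r') (apply f (from r'))) ,
  (λ f → fun λ r → proj₂ (e r (to r)) (apply f (to r)))

infix 4 _∶_≈ne_∶_ _≈ne_

-- Demanding a common readback at every level m replaces the choice of fresh names.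
_∶_≈ne_∶_ : Exp → Exp → Exp → Exp → Set
n ∶ T ≈ne n' ∶ T' = ∀ m → ∃[ v ] m ⊢ n ⇓ne v ∶ T × m ⊢ n' ⇓ne v ∶ T'

-- The types are outputs of readback and may differ on the two sides; quantifying them away leaves a
-- relation on neutrals alone.
_≈ne_ : Rel Exp 0ℓ
n ≈ne n' = ∃₂ λ T T' → n ∶ T ≈ne n' ∶ T'

≈ne-neutralˡ : ∀ {n n'} → n ≈ne n' → NeutralE n
≈ne-neutralˡ (_ , _ , h) = let _ , d , _ = h 0 in ⇓ne-neutral d

≈ne-neutralʳ : ∀ {n n'} → n ≈ne n' → NeutralE n'
≈ne-neutralʳ (_ , _ , h) = let _ , _ , d = h 0 in ⇓ne-neutral d

≈ne-per : PER _≈ne_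
≈ne-per = record
  { sym   = λ (_ , _ , h) → _ , _ , λ m → let v , d , d' = h m in v , d' , d
  ; trans = λ { (_ , _ , h) (_ , _ , h') → _ , _ , λ m → compose (h m) (h' m) } }
  where
  compose : ∀ {m n n' n'' T T₁ T₂ T''} →
            ∃[ v ] m ⊢ n ⇓ne v ∶ T × m ⊢ n' ⇓ne v ∶ T₁ →
            ∃[ v ] m ⊢ n' ⇓ne v ∶ T₂ × m ⊢ n'' ⇓ne v ∶ T'' →
            ∃[ v ] m ⊢ n ⇓ne v ∶ T × m ⊢ n'' ⇓ne v ∶ T''
  compose (v , c , d) (v' , c' , d') with refl , _ ← ⇓ne-det d c' = v , c , d'

-- P selects the sorts that are types of the universe, and R i interprets Set_i.
-- The PER premise of pi makes El-per and ≈-sym structural inductions, independent of ≈-trans.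
module Model (P : ℕ → Set) (R : ℕ → Rel Exp 0ℓ) where

  infix 4 _≈_ _≈ʷ_

  -- Induction-recursion: the codomain clause of `pi` ranges over arguments related by the
  -- interpretation of the domain. For `irr` these are all pairs, so any two instances of the family
  -- must be related.
  mutual
    data _≈_ : Exp → Exp → Set where
      whnf : ∀ {A A' B B'} → A ⇘ A' → B ⇘ B' → A' ≈ʷ B' → A ≈ B

    data _≈ʷ_ : Exp → Exp → Set where
      srt : ∀ {i} → P i → srt i ≈ʷ srt i
      ne  : ∀ {N N'} → NeutralE N → NeutralE N' → N ≈ne N' → N ≈ʷ N'
      pi  : ∀ {a i j U U' T T'} (p : U ≈ U') → PER (El p) →
            (∀ {u u'} → Restrict a (El p) u u' → T ⟨ u ⟩ ≈ T' ⟨ u' ⟩) →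
            pi a i j U T ≈ʷ pi a i j U' T'

    El : ∀ {A B} → A ≈ B → Rel Exp 0ℓ
    El (whnf _ _ w) = Elʷ w

    Elʷ : ∀ {A B} → A ≈ʷ B → Rel Exp 0ℓ
    Elʷ (srt {i} _)      t t' = R i t t'
    Elʷ (ne _ _ _)       t t' = ∃₂ λ n n' → t ⇘ n × t' ⇘ n' × n ≈ne n'
    Elʷ (pi {a} p _ q)   t t' = FunRel a (Restrict a (El p)) (λ r → El (q r)) t t'

  mutual
    -- Both proofs evaluate the same `A`, so by determinism their outermost constructors agree: the
    -- interpretation is governed by the left-hand type. `El-irrʳ` is the mirror image.
    El-irrˡ : ∀ {A B C} (p : A ≈ B) (q : A ≈ C) → El p ⇔ El q
    El-irrˡ (whnf d _ p) (whnf e _ q) with refl ← ⇘-det d e = Elʷ-irrˡ p q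

    Elʷ-irrˡ : ∀ {A B C} (p : A ≈ʷ B) (q : A ≈ʷ C) → Elʷ p ⇔ Elʷ q
    Elʷ-irrˡ (srt _) (srt _)           = ⇔-refl
    Elʷ-irrˡ (ne _ _ _) (ne _ _ _)     = ⇔-refl
    Elʷ-irrˡ (pi {a} p _ q) (pi p' _ q') =
      FunRel-⇔ (restrict-⇔ a (El-irrˡ p p')) (λ r r' → El-irrˡ (q r) (q' r'))
    Elʷ-irrˡ (srt _) (ne () _ _)
    Elʷ-irrˡ (pi _ _ _) (ne () _ _)
    Elʷ-irrˡ (ne () _ _) (srt _)
    Elʷ-irrˡ (ne () _ _) (pi _ _ _)

  mutual
    El-irrʳ : ∀ {A B C} (p : A ≈ C) (q : B ≈ C) → El p ⇔ El q
    El-irrʳ (whnf _ d p) (whnf _ e q) with refl ← ⇘-det d e = Elʷ-irrʳ p q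

    Elʷ-irrʳ : ∀ {A B C} (p : A ≈ʷ C) (q : B ≈ʷ C) → Elʷ p ⇔ Elʷ q
    Elʷ-irrʳ (srt _) (srt _)           = ⇔-refl
    Elʷ-irrʳ (ne _ _ _) (ne _ _ _)     = ⇔-refl
    Elʷ-irrʳ (pi {a} p _ q) (pi p' _ q') =
      FunRel-⇔ (restrict-⇔ a (El-irrʳ p p')) (λ r r' → El-irrʳ (q r) (q' r'))
    Elʷ-irrʳ (srt _) (ne _ () _)
    Elʷ-irrʳ (pi _ _ _) (ne _ () _)
    Elʷ-irrʳ (ne _ () _) (srt _)
    Elʷ-irrʳ (ne _ () _) (pi _ _ _)

-- What a model must know about each sort it contains: `neutral` serves reflection at that sort,
-- `readback` serves reification.
record IsUniverse (_~_ : Rel Exp 0ℓ) : Set where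
  field
    per      : PER _~_
    expand   : ∀ {t t' s s'} → t ≽ s → t' ≽ s' → s ~ s' → t ~ t'
    neutral  : ∀ {n n'} → n ≈ne n' → n ~ n'
    readback : ∀ {t t'} → t ~ t' → ∀ m → ∃[ V ] m ⊢ t ⇓ty V × m ⊢ t' ⇓ty V

-- Partial equivalence, reification and reflection for a single universe.

module Theory (P : ℕ → Set) (R : ℕ → Rel Exp 0ℓ) (univ : ∀ {i} → P i → IsUniverse (R i)) where

  open Model P R
  open IsPartialEquivalence using () renaming (sym to per-sym; trans to per-trans)

  mutual
    El-per : ∀ {A B} (p : A ≈ B) → PER (El p)
    El-per (whnf _ _ w) = Elʷ-per w

    Elʷ-per : ∀ {A B} (p : A ≈ʷ B) → PER (Elʷ p)
    Elʷ-per (srt i) = IsUniverse.per (univ i)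
    Elʷ-per (ne _ _ _) = record
      { sym   = λ (n , n' , d , d' , h) → n' , n , d' , d , per-sym ≈ne-per h
      ; trans = compose }
      where
      compose : ∀ {t t' t''} →
                (∃₂ λ n n' → t ⇘ n × t' ⇘ n' × n ≈ne n') → (∃₂ λ n n' → t' ⇘ n × t'' ⇘ n' × n ≈ne n') →
                ∃₂ λ n n' → t ⇘ n × t'' ⇘ n' × n ≈ne n'
      compose (_ , _ , d , d' , h) (_ , _ , e , e' , k) with refl ← ⇘-det d' e =
        _ , _ , d , e' , per-trans ≈ne-per h k
    Elʷ-per (pi {a} p per q) = record
      -- In general `q r'` and `q r` have no type in common. The diagonal `q s` shares its
      -- right-hand type with `q r'` and its left-hand type with `q r`.
      { sym = λ f → fun λ r →
          let open IsPartialEquivalence (restrict-per a per) renaming (sym to ~-sym)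
              r' = ~-sym r
              s  = per-reflˡ (restrict-per a per) r
          in proj₁ (El-irrˡ (q s) (q r)) (proj₁ (El-irrʳ (q r') (q s)) (per-sym (El-per (q r')) (apply f r')))
      ; trans = λ f g → fun λ r →
          let s = per-reflʳ (restrict-per a per) r
          in per-trans (El-per (q r)) (apply f r) (proj₁ (El-irrʳ (q s) (q r)) (apply g s)) }

  mutual
    -- To reverse a `pi`, arguments related at the reversed domain must be related at the original
    -- one; hence the simultaneous proof that `El` is unchanged.
    ≈-sym : ∀ {A B} → A ≈ B → B ≈ A
    ≈-sym (whnf d e w) = whnf e d (≈ʷ-sym w)

    ≈ʷ-sym : ∀ {A B} → A ≈ʷ B → B ≈ʷ A
    ≈ʷ-sym (srt i)     = srt i
    ≈ʷ-sym (ne n n' h) = ne n' n (per-sym ≈ne-per h)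
    ≈ʷ-sym (pi {a} p per q) = pi (≈-sym p) (per-resp-⇔ per (El-≈-sym p)) λ r →
      ≈-sym (q (per-sym (restrict-per a per) (proj₂ (restrict-⇔ a (El-≈-sym p)) r)))

    El-≈-sym : ∀ {A B} (p : A ≈ B) → El p ⇔ El (≈-sym p)
    El-≈-sym (whnf _ _ w) = Elʷ-≈ʷ-sym w

    Elʷ-≈ʷ-sym : ∀ {A B} (p : A ≈ʷ B) → Elʷ p ⇔ Elʷ (≈ʷ-sym p)
    Elʷ-≈ʷ-sym (srt i)          = ⇔-refl
    Elʷ-≈ʷ-sym (ne _ _ _)       = ⇔-refl
    Elʷ-≈ʷ-sym (pi {a} p per q) = FunRel-⇔ (restrict-⇔ a (El-≈-sym p)) λ r r' →
      let s = per-reflˡ (restrict-per a per) r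
      in ⇔-trans (El-irrˡ (q r) (q s)) (⇔-trans (El-irrʳ (q s) (q (flip r'))) (El-≈-sym (q (flip r'))))
      where
      flip : ∀ {u u'} → Restrict a (El (≈-sym p)) u u' → Restrict a (El p) u' u
      flip r = per-sym (restrict-per a per) (proj₂ (restrict-⇔ a (El-≈-sym p)) r)

  El-irrᶜ : ∀ {A B C} (p : A ≈ B) (q : B ≈ C) → El p ⇔ El q
  El-irrᶜ p q = ⇔-trans (El-≈-sym p) (El-irrˡ (≈-sym p) q)

  mutual
    ≈-trans : ∀ {A B C} → A ≈ B → B ≈ C → A ≈ C
    ≈-trans (whnf d e p) (whnf d' e' q) with refl ← ⇘-det e d' = whnf d e' (≈ʷ-trans p q)

    ≈ʷ-trans : ∀ {A B C} → A ≈ʷ B → B ≈ʷ C → A ≈ʷ C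
    ≈ʷ-trans (srt i) (srt _)             = srt i
    ≈ʷ-trans (ne n _ h) (ne _ n' k)      = ne n n' (per-trans ≈ne-per h k)
    ≈ʷ-trans (pi {a} p perᵖ q) (pi p' _ q') = pi (≈-trans p p') (El-per (≈-trans p p')) λ r →
      -- The first family is followed at `u`, `u` and the second at `u`, `u'`, so that they meet in
      -- the same instance of the middle family.
      let s = proj₁ (restrict-⇔ a (El-irrˡ (≈-trans p p') p)) r
      in ≈-trans (q (per-reflˡ (restrict-per a perᵖ) s)) (q' (proj₁ (restrict-⇔ a (El-irrᶜ p p')) s))
    ≈ʷ-trans (srt _) (ne () _ _)
    ≈ʷ-trans (pi _ _ _) (ne () _ _)
    ≈ʷ-trans (ne _ () _) (srt _)
    ≈ʷ-trans (ne _ () _) (pi _ _ _)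

  ≈-per : PER _≈_
  ≈-per = record { sym = ≈-sym ; trans = ≈-trans }

  ≈-expand : ∀ {A A' B B'} → A ≽ A' → B ≽ B' → A' ≈ B' → A ≈ B
  ≈-expand r r' (whnf d e w) = whnf (r d) (r' e) w

  mutual
    El-expand : ∀ {A B t t' s s'} (p : A ≈ B) → t ≽ s → t' ≽ s' → El p s s' → El p t t'
    El-expand (whnf _ _ w) = Elʷ-expand w

    Elʷ-expand : ∀ {A B t t' s s'} (p : A ≈ʷ B) → t ≽ s → t' ≽ s' → Elʷ p s s' → Elʷ p t t'
    Elʷ-expand (srt i) r r'      = IsUniverse.expand (univ i) r r'
    Elʷ-expand (ne _ _ _) r r' (_ , _ , d , d' , h) = _ , _ , r d , r' d' , h
    Elʷ-expand (pi _ _ q) r r' f = fun λ x → El-expand (q x) (≽-app r) (≽-app r') (apply f x)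

  mutual
    -- The reify and reflect pair of normalisation by evaluation. A function is read back by
    -- applying it to a fresh parameter, which lies in the relation by reflection; a neutral
    -- function is reflected by reading back its relevant arguments.
    reify-ty : ∀ {A B} → A ≈ B → ∀ m → ∃[ V ] m ⊢ A ⇓ty V × m ⊢ B ⇓ty V
    reify-ty (whnf d e w) m = let V , c , c' = reify-tyʷ w m in V , eval-ty d c , eval-ty e c'

    reify-tyʷ : ∀ {A B} → A ≈ʷ B → ∀ m → ∃[ V ] m ⊢ A ↓ty V × m ⊢ B ↓ty V
    reify-tyʷ (srt {i} _) m = srt i , ↓ty-srt , ↓ty-srt
    reify-tyʷ (ne _ _ (_ , _ , h)) m = let v , d , d' = h m in ne v , ↓ty-ne d , ↓ty-ne d'
    reify-tyʷ (pi {a} {i} {j} p _ q) m =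
      let V , c , c' = reify-ty p m
          W , d , d' = reify-ty (q (fresh a m p)) (suc m)
      in pi a i j V W , ↓ty-pi c d , ↓ty-pi c' d'

    reify : ∀ {A B t t'} (p : A ≈ B) → El p t t' → ∀ m → ∃[ v ] m ⊢ t ⇓tm v ∶ A × m ⊢ t' ⇓tm v ∶ B
    reify (whnf d e w) r m = let v , c , c' = reifyʷ w r m in v , eval-tm d c , eval-tm e c'

    reifyʷ : ∀ {A B t t'} (p : A ≈ʷ B) → Elʷ p t t' → ∀ m → ∃[ v ] m ⊢ t ↓tm v ∶ A × m ⊢ t' ↓tm v ∶ B
    reifyʷ (srt i) r m =
      let V , c , c' = IsUniverse.readback (univ i) r m in ty V , ↓tm-srt c , ↓tm-srt c'
    reifyʷ (ne n n' _) (_ , _ , d , d' , _ , _ , h) m =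
      let v , c , c' = h m in ne v , ↓tm-ne n d c , ↓tm-ne n' d' c'
    reifyʷ (pi {a} p _ q) f m =
      let x = fresh a m p
          v , c , c' = reify (q x) (apply f x) (suc m)
      in lam a v , ↓tm-pi c , ↓tm-pi c'

    reflect : ∀ {A B n n'} (p : A ≈ B) → n ∶ A ≈ne n' ∶ B → El p n n'
    reflect (whnf d e w) h = reflectʷ d e w h

    reflectʷ : ∀ {A A' B B' n n'} → A ⇘ A' → B ⇘ B' → (p : A' ≈ʷ B') → n ∶ A ≈ne n' ∶ B → Elʷ p n n'
    reflectʷ d e (srt i) h = IsUniverse.neutral (univ i) (_ , _ , h)
    reflectʷ d e (ne _ _ _) h =
      _ , _ , ev-whnf (wh-ne (≈ne-neutralˡ (_ , _ , h))) , ev-whnf (wh-ne (≈ne-neutralʳ (_ , _ , h))) , _ , _ , h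
    reflectʷ d e (pi {rel} p _ q) h = fun λ r → reflect (q r) λ m →
      let v , c , c' = h m
          w , b , b' = reify p r m
      in app v w , ⇓ne-rel c d b , ⇓ne-rel c' e b'
    reflectʷ d e (pi {irr} p _ q) h = fun λ r → reflect (q r) λ m →
      let v , c , c' = h m in irr v , ⇓ne-irr c d , ⇓ne-irr c' e

    -- Each side carries its own type, but `var l` records only the shared level.
    fresh : ∀ a l {A B} (p : A ≈ B) → Restrict a (El p) (par a l A) (par a l B)
    fresh rel l p = reflect p λ m → var l , ⇓ne-par , ⇓ne-par
    fresh irr l p = tt

  ≈-neutral : ∀ {n n'} → n ≈ne n' → n ≈ n'
  ≈-neutral h = whnf (ev-whnf (wh-ne n)) (ev-whnf (wh-ne n')) (ne n n' h)
    where
    n  = ≈ne-neutralˡ h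
    n' = ≈ne-neutralʳ h

  isUniverse : IsUniverse _≈_
  isUniverse = record { per = ≈-per ; expand = ≈-expand ; neutral = ≈-neutral ; readback = reify-ty }

-- Cumulativity and the hierarchy of universes.

module Embedding {P P' : ℕ → Set} {R R' : ℕ → Rel Exp 0ℓ}
                 (P⊆P' : ∀ {i} → P i → P' i) (R⇔R' : ∀ {i} → P i → R i ⇔ R' i) where
  private
    module M  = Model P R
    module M' = Model P' R'

  mutual
    -- Related arguments occur to the left of an arrow in `pi`, so types pass to the larger model
    -- only together with an equivalence of interpretations; an inclusion would not do.
    embed : ∀ {A B} → A M.≈ B → A M'.≈ B
    embed (M.whnf d e w) = M'.whnf d e (embedʷ w)

    embedʷ : ∀ {A B} → A M.≈ʷ B → A M'.≈ʷ B
    embedʷ (M.srt i)     = M'.srt (P⊆P' i)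
    embedʷ (M.ne n n' h) = M'.ne n n' h
    embedʷ (M.pi {a} p per q) = M'.pi (embed p) (per-resp-⇔ per (El-embed p)) λ r →
      embed (q (proj₂ (restrict-⇔ a (El-embed p)) r))

    El-embed : ∀ {A B} (p : A M.≈ B) → M.El p ⇔ M'.El (embed p)
    El-embed (M.whnf _ _ w) = Elʷ-embed w

    Elʷ-embed : ∀ {A B} (p : A M.≈ʷ B) → M.Elʷ p ⇔ M'.Elʷ (embedʷ p)
    Elʷ-embed (M.srt i)     = R⇔R' i
    Elʷ-embed (M.ne _ _ _)  = ⇔-refl
    Elʷ-embed (M.pi {a} p per q) = FunRel-⇔ (restrict-⇔ a (El-embed p)) λ r r' →
      let s = proj₂ (restrict-⇔ a (El-embed p)) r'
      in ⇔-trans (M.El-irrˡ (q r) (q s)) (El-embed (q s))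

-- The hierarchy by structural recursion: `Below k i` searches downwards from `k` for `i`. The empty
-- relation is reached only when `i` is not below `k`, which the predicate `_< k` excludes.
mutual
  U : ℕ → Rel Exp 0ℓ
  U k = Model._≈_ (_< k) (Below k)

  Below : ℕ → ℕ → Rel Exp 0ℓ
  Below zero    i = λ _ _ → ⊥
  Below (suc k) i with i ≟ k
  ... | yes _ = U k
  ... | no _  = Below k i

Below≐U : ∀ {i} k → i < k → Below k i ≐ U i
Below≐U {i} (suc k) i<1+k with i ≟ k
... | yes refl = refl
... | no i≢k   = Below≐U k (≤∧≢⇒< (≤-pred i<1+k) i≢k)

Below-isUniverse : ∀ {i} k → i < k → IsUniverse (Below k i)
Below-isUniverse {i} (suc k) i<1+k with i ≟ k
... | yes refl = Theory.isUniverse (_< k) (Below k) (Below-isUniverse k)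
... | no i≢k   = Below-isUniverse k (≤∧≢⇒< (≤-pred i<1+k) i≢k)

U-isUniverse : ∀ k → IsUniverse (U k)
U-isUniverse k = Theory.isUniverse (_< k) (Below k) (Below-isUniverse k)

module Cumulativity {i k} (i≤k : i ≤ k) = Embedding {R = Below i} {R' = Below k}
  (λ j<i → <-≤-trans j<i i≤k)
  (λ {j} j<i → subst₂ _⇔_ (sym (Below≐U i j<i)) (sym (Below≐U k (<-≤-trans j<i i≤k))) ⇔-refl)

-- Types of the calculus live in the limit universe, which contains every Set_i.
open Model (λ _ → ⊤) U
open Theory (λ _ → ⊤) U (λ {i} _ → U-isUniverse i)

module Lift k = Embedding {P = _< k} {R = Below k} {R' = U} (λ _ → tt)
  (λ {j} j<k → subst (_⇔ U j) (sym (Below≐U k j<k)) ⇔-refl)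

-- The fundamental theorem

private
  open module PERs {A B} (p : A ≈ B) = IsPartialEquivalence (El-per p) using () renaming (sym to El-sym; trans to El-trans)

-- Two environments turn one type into two expressions, so terms are compared along a pair of
-- related types.
Related : Exp → Exp → Rel Exp 0ℓ
Related A B t t' = Σ[ p ∈ A ≈ B ] El p t t'

Related-sym : ∀ {A B t t'} → Related A B t t' → Related B A t' t
Related-sym (p , r) = ≈-sym p , proj₁ (El-≈-sym p) (El-sym p r)

Related-trans : ∀ {A B C t t' t''} → Related A B t t' → Related B C t' t'' → Related A C t t''
Related-trans (p , r) (q , s) =
  ≈-trans p q ,
  El-trans (≈-trans p q) (proj₁ (El-irrˡ p (≈-trans p q)) r) (proj₁ (El-irrʳ q (≈-trans p q)) s)

-- A valid equation between types, used at `σ`, `σ` and at `σ`, `σ'`, supplies two relations that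
-- both start from `A`.
Related-conv : ∀ {A A' B B' t t'} → A ≈ A' → A ≈ B' → Related A B t t' → Related A' B' t t'
Related-conv p q (o , r) =
  ≈-trans (≈-sym p) q , proj₁ (El-irrʳ q (≈-trans (≈-sym p) q)) (proj₁ (El-irrˡ o q) r)

Related-expand : ∀ {A B t t' s s'} → t ≽ s → t' ≽ s' → Related A B s s' → Related A B t t'
Related-expand h h' (p , r) = p , El-expand p h h' r

Related-resp : ∀ {A A' B B' t t' s s'} → A ≐ A' → B ≐ B' → t ≐ t' → s ≐ s' → Related A B t s → Related A' B' t' s'
Related-resp refl refl refl refl r = r

U⇒≈ : ∀ {i A B} → U i A B → A ≈ B
U⇒≈ {i} = Lift.embed i

srt-intro : ∀ {i A B} → U i A B → Related (srt i) (srt i) A B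
srt-intro r = whnf (ev-whnf wh-srt) (ev-whnf wh-srt) (srt tt) , r

srt-elim : ∀ {i A B} → Related (srt i) (srt i) A B → U i A B
srt-elim (whnf d e w , r) with refl ← whnf-⇘ wh-srt d | refl ← whnf-⇘ wh-srt e with w
... | srt _     = r
... | ne () _ _

srt⇒≈ : ∀ {i A B} → Related (srt i) (srt i) A B → A ≈ B
srt⇒≈ {i} r = U⇒≈ {i} (srt-elim r)

pi-elim : ∀ {a i j U U' T T' t t'} → Related (pi a i j U T) (pi a i j U' T') t t' →
          Σ[ p ∈ U ≈ U' ] (∀ {u u'} → Restrict a (El p) u u' →
                            Related (T ⟨ u ⟩) (T' ⟨ u' ⟩) (app a t u) (app a t' u'))
pi-elim (whnf d e w , f) with refl ← whnf-⇘ wh-pi d | refl ← whnf-⇘ wh-pi e with w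
... | pi p _ q  = p , λ r → q r , apply f r
... | ne () _ _

-- Quantifying over `q` spares the caller from knowing which domain proof is stored inside `p`.
pi-intro : ∀ {a i j U U' T T' t t'} (p : pi a i j U T ≈ pi a i j U' T') →
           (∀ {u u'} (q : U ≈ U') → Restrict a (El q) u u' →
             Related (T ⟨ u ⟩) (T' ⟨ u' ⟩) (app a t u) (app a t' u')) →
           El p t t'
pi-intro (whnf d e w) f with refl ← whnf-⇘ wh-pi d | refl ← whnf-⇘ wh-pi e with w
... | pi p _ q  = fun λ r → let o , s = f p r in proj₁ (El-irrˡ o (q r)) s
... | ne () _ _

pi-formation : ∀ {a i j A A' σ σ' B B'} → U i A A' →
               (∀ {u u'} (p : A ≈ A') → Restrict a (El p) u u' → U j (inst (u ∷ σ) B) (inst (u' ∷ σ') B')) →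
               U (i ⊔ j) (pi a i j A (inst (lift σ) B)) (pi a i j A' (inst (lift σ') B'))
pi-formation {a} {i} {j} {σ = σ} {σ'} {B} {B'} p q =
  M.whnf (ev-whnf wh-pi) (ev-whnf wh-pi) (M.pi p⊔ (per-resp-⇔ (El-per (U⇒≈ {i} p)) e) λ {u} {u'} r →
    subst₂ (U (i ⊔ j)) (sym (inst-lift-⟨⟩ σ B u)) (sym (inst-lift-⟨⟩ σ' B' u'))
      (Cumulativity.embed (m≤n⊔m i j) (q (U⇒≈ {i} p) (proj₂ (restrict-⇔ a e) r))))
  where
  module M = Model (_< i ⊔ j) (Below (i ⊔ j))
  p⊔ = Cumulativity.embed (m≤m⊔n i j) p
  -- The limit universe and universe `i ⊔ j` both extend universe `i`, and through it they interpret
  -- the domain alike.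
  e : El (U⇒≈ {i} p) ⇔ M.El p⊔
  e = ⇔-trans (⇔-sym (Lift.El-embed i p)) (Cumulativity.El-embed (m≤m⊔n i j) p)

⟦_⟧ : Ctx → Rel Subst 0ℓ
⟦ ε ⟧ σ σ'             = ⊤
⟦ Γ ▸ (rel , T) ⟧ σ σ' =
  ⟦ Γ ⟧ (σ ∘ suc) (σ' ∘ suc) × Related (inst (σ ∘ suc) T) (inst (σ' ∘ suc) T) (σ 0) (σ' 0)
⟦ Γ ▸ (irr , T) ⟧ σ σ' = ⟦ Γ ⟧ (σ ∘ suc) (σ' ∘ suc)

⟦⟧-sym : ∀ Γ {σ σ'} → ⟦ Γ ⟧ σ σ' → ⟦ Γ ⟧ σ' σ
⟦⟧-sym ε γ                   = tt
⟦⟧-sym (Γ ▸ (rel , T)) (γ , r) = ⟦⟧-sym Γ γ , Related-sym r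
⟦⟧-sym (Γ ▸ (irr , T)) γ     = ⟦⟧-sym Γ γ

⟦⟧-trans : ∀ Γ {σ σ' σ''} → ⟦ Γ ⟧ σ σ' → ⟦ Γ ⟧ σ' σ'' → ⟦ Γ ⟧ σ σ''
⟦⟧-trans ε γ δ                         = tt
⟦⟧-trans (Γ ▸ (rel , T)) (γ , r) (δ , s) = ⟦⟧-trans Γ γ δ , Related-trans r s
⟦⟧-trans (Γ ▸ (irr , T)) γ δ           = ⟦⟧-trans Γ γ δ

⟦⟧-reflˡ : ∀ Γ {σ σ'} → ⟦ Γ ⟧ σ σ' → ⟦ Γ ⟧ σ σ
⟦⟧-reflˡ Γ γ = ⟦⟧-trans Γ γ (⟦⟧-sym Γ γ)

⟦⟧-reflʳ : ∀ Γ {σ σ'} → ⟦ Γ ⟧ σ σ' → ⟦ Γ ⟧ σ' σ'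
⟦⟧-reflʳ Γ γ = ⟦⟧-trans Γ (⟦⟧-sym Γ γ) γ

extend : ∀ {Γ U σ σ' u u'} a → ⟦ Γ ⟧ σ σ' → (p : inst σ U ≈ inst σ' U) → Restrict a (El p) u u' →
         ⟦ Γ ▸ (a , U) ⟧ (u ∷ σ) (u' ∷ σ')
extend rel γ p r = γ , p , r
extend irr γ p r = γ

β-inst : ∀ {a A u σ} t → app a (lam a A (inst (lift σ) t)) u ≽ inst (u ∷ σ) t
β-inst {u = u} {σ} t d = ≽-β (subst (_⇘ _) (sym (inst-lift-⟨⟩ σ t u)) d)

convert-arg : ∀ a {A B C u u'} (p : A ≈ B) (q : A ≈ C) → Restrict a (El p) u u' → Restrict a (El q) u u'
convert-arg a p q = proj₁ (restrict-⇔ a (El-irrˡ p q))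

-- Using two related environments builds in functionality, which the congruence rules under binders
-- rely on.
record Valid (Γ : Ctx) (t t' T : Tm) : Set where
  constructor valid
  field related : ∀ {σ σ'} → ⟦ Γ ⟧ σ σ' → Related (inst σ T) (inst σ' T) (inst σ t) (inst σ' t')

open Valid

valid-sym : ∀ {Γ t t' T} → Valid Γ t t' T → Valid Γ t' t T
valid-sym {Γ} h = valid λ γ → Related-sym (related h (⟦⟧-sym Γ γ))

valid-trans : ∀ {Γ t t' t'' T} → Valid Γ t t' T → Valid Γ t' t'' T → Valid Γ t t'' T
valid-trans {Γ} h k = valid λ γ → Related-trans (related h γ) (related k (⟦⟧-reflʳ Γ γ))

-- Stands in for the syntactic presupposition that the left-hand side of an equation is well typed.
valid-reflˡ : ∀ {Γ t t' T} → Valid Γ t t' T → Valid Γ t t T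
valid-reflˡ h = valid-trans h (valid-sym h)

valid-conv : ∀ {Γ t t' T T' k} → Valid Γ T T' (srt k) → Valid Γ t t' T → Valid Γ t t' T'
valid-conv {Γ} e h = valid λ γ →
  Related-conv (srt⇒≈ (related e (⟦⟧-reflˡ Γ γ))) (srt⇒≈ (related e γ)) (related h γ)

valid-srt : ∀ {Γ} i → Valid Γ (srt i) (srt i) (srt (suc i))
valid-srt i = valid λ _ → srt-intro (M.whnf (ev-whnf wh-srt) (ev-whnf wh-srt) (M.srt (n<1+n i)))
  where module M = Model (_< suc i) (Below (suc i))

valid-pi : ∀ {Γ a i j A A' B B'} → Valid Γ A A' (srt i) → Valid (Γ ▸ (a , A)) B B' (srt j) →
           Valid Γ (pi a i j A B) (pi a i j A' B') (srt (i ⊔ j))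
valid-pi {a = a} {i} {B = B} {B'} hA hB = valid λ {σ} {σ'} γ →
  srt-intro (pi-formation {i = i} {σ = σ} {σ'} {B} {B'} (srt-elim (related hA γ)) λ p r →
    -- The extended context gives both arguments type `A`, while `r` relates them along `A` and
    -- `A'`; the left-hand type is common.
    let q = srt⇒≈ (related (valid-reflˡ hA) γ)
    in srt-elim (related hB (extend a γ q (convert-arg a p q r))))

valid-lam : ∀ {Γ a i j k A A' B t t'} → Valid Γ (pi a i j A B) (pi a i j A B) (srt k) →
            Valid (Γ ▸ (a , A)) t t' B → Valid Γ (lam a A t) (lam a A' t') (pi a i j A B)
valid-lam {a = a} {B = B} {t} {t'} hP ht = valid λ {σ} {σ'} γ →
  let P = srt⇒≈ (related hP γ) in
  P , pi-intro P λ {u} {u'} p r →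
    Related-expand (β-inst t) (β-inst t')
      (Related-resp (sym (inst-lift-⟨⟩ σ B u)) (sym (inst-lift-⟨⟩ σ' B u')) refl refl
        (related ht (extend a γ p r)))

∋-valid : ∀ {Γ x T} → Γ ∋ x ∶ T → Valid Γ (var x) (var x) T
∋-valid (here {U = U}) = valid λ { {σ} {σ'} (_ , r) →
  Related-resp (sym (inst-ren σ suc U)) (sym (inst-ren σ' suc U)) refl refl r }
∋-valid (there {U = U} {b = rel} x) = valid λ { {σ} {σ'} (γ , _) →
  Related-resp (sym (inst-ren σ suc U)) (sym (inst-ren σ' suc U)) refl refl (related (∋-valid x) γ) }
∋-valid (there {U = U} {b = irr} x) = valid λ {σ} {σ'} γ →
  Related-resp (sym (inst-ren σ suc U)) (sym (inst-ren σ' suc U)) refl refl (related (∋-valid x) γ)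

ValidArg : Ann → Ctx → Tm → Tm → Tm → Set
ValidArg rel = Valid
ValidArg irr _ _ _ _ = ⊤

validArg-restrict : ∀ a {Γ u u' T σ σ'} → ValidArg a Γ u u' T → ⟦ Γ ⟧ σ σ' → (p : inst σ T ≈ inst σ' T) →
                    Restrict a (El p) (inst σ u) (inst σ' u')
validArg-restrict rel h γ p = let q , r = related h γ in proj₁ (El-irrˡ q p) r
validArg-restrict irr h γ p = tt

validArg-reflˡ : ∀ a {Γ u u' T} → ValidArg a Γ u u' T → ValidArg a Γ u u T
validArg-reflˡ rel h = valid-reflˡ h
validArg-reflˡ irr h = tt

valid-app : ∀ {Γ a i j A B t t' u u'} → Valid Γ t t' (pi a i j A B) → ValidArg a Γ u u' A →
            Valid Γ (app a t u) (app a t' u') (B [ u ])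
valid-app {a = a} {B = B} {u = u} ht hu = valid λ {σ} {σ'} γ →
  let p , f = pi-elim (related ht γ)
      q , r = f (validArg-restrict a hu γ p)
      -- `q` ends in the instance of `B` at `u'`, but the conclusion has `B [ u ]` on both sides.
      -- Using `u` twice gives the right pair of types, with the same left-hand one.
      o , _ = f (validArg-restrict a (validArg-reflˡ a hu) γ p)
  in Related-resp (inst-lift-[] σ B u) (inst-lift-[] σ' B u) refl refl (o , proj₁ (El-irrˡ q o) r)

valid-β : ∀ {Γ a A B t u} → Valid (Γ ▸ (a , A)) t t B → ValidArg a Γ u u A →
          Valid Γ (app a (lam a A t) u) (t [ u ]) (B [ u ])
valid-β {Γ} {a} {A} {B} {t} {u} ht hu = valid λ {σ} {σ'} γ →
  Related-expand (β-inst t) id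
    (Related-resp (sym (inst-[] σ B u)) (sym (inst-[] σ' B u)) refl (sym (inst-[] σ' t u))
      (related ht (extend-arg a hu γ)))
  where
  extend-arg : ∀ a {σ σ'} → ValidArg a Γ u u A → ⟦ Γ ⟧ σ σ' → ⟦ Γ ▸ (a , A) ⟧ (inst σ u ∷ σ) (inst σ' u ∷ σ')
  extend-arg rel h γ = γ , related h γ
  extend-arg irr h γ = γ

-- Functions are observed only through application, and the η-expansion applied to `u'` evaluates to
-- whatever `t` applied to `u'` does.
valid-η : ∀ {Γ a i j A B t} → Valid Γ t t (pi a i j A B) →
          Valid Γ t (lam a A (app a (wk t) (var zero))) (pi a i j A B)
valid-η {a = a} {A = A} {t = t} ht = valid λ {σ} {σ'} γ →
  let P , f = related ht γ
      p , g = pi-elim (P , f)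
  in P , pi-intro P λ {u} {u'} q r → Related-expand id (expand σ' u') (g (convert-arg a q p r))
  where
  expand : ∀ σ u → app a (inst σ (lam a A (app a (wk t) (var zero)))) u ≽ app a (inst σ t) u
  expand σ u d = β-inst (app a (wk t) (var zero)) (subst (λ s → app a s u ⇘ _) (sym (inst-wk {u} {σ} t)) d)

mutual
  fundamental : ∀ {Γ t T} → Γ ⊢ t ∶ T → Valid Γ t t T
  fundamental (ty-srt {i = i} _)  = valid-srt i
  fundamental (ty-pi dU dT)       = valid-pi (fundamental dU) (fundamental dT)
  fundamental (ty-var _ x)        = ∋-valid x
  fundamental (ty-lam d (_ , dP)) = valid-lam (fundamental dP) (fundamental d)
  fundamental (ty-app {a = a} d e) = valid-app (fundamental d) (fundamental-arg a e)
  fundamental (ty-conv d (_ , e)) = valid-conv (fundamental-eq e) (fundamental d)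

  fundamental-arg : ∀ a {Γ u T} → ctxFor a Γ ⊢ u ∶ T → ValidArg a Γ u u T
  fundamental-arg rel d = fundamental d
  fundamental-arg irr d = tt

  fundamental-eq : ∀ {Γ t t' T} → Γ ⊢ t ≡ t' ∶ T → Valid Γ t t' T
  fundamental-eq (eq-β {a = a} d e)  = valid-β (fundamental d) (fundamental-arg a e)
  fundamental-eq (eq-η d)            = valid-η (fundamental d)
  fundamental-eq (eq-refl d)         = fundamental d
  fundamental-eq (eq-sym d)          = valid-sym (fundamental-eq d)
  fundamental-eq (eq-trans d e)      = valid-trans (fundamental-eq d) (fundamental-eq e)
  fundamental-eq (eq-pi dU dT)       = valid-pi (fundamental-eq dU) (fundamental-eq dT)
  fundamental-eq (eq-lam dU dT dt)   =
    valid-lam (valid-pi (valid-reflˡ (fundamental-eq dU)) (fundamental dT)) (fundamental-eq dt)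
  fundamental-eq (eq-app d e)        = valid-app (fundamental-eq d) (fundamental-eq-arg e)
  fundamental-eq (eq-conv d (_ , e)) = valid-conv (fundamental-eq e) (fundamental-eq d)

  fundamental-eq-arg : ∀ {a Γ u u' T} → Γ ⊢ u ≡ u' ∶[ a ] T → ValidArg a Γ u u' T
  fundamental-eq-arg (eq-rel d)   = fundamental-eq d
  fundamental-eq-arg (eq-irr _ _) = tt

-- Naming the variables of a context

size : Ctx → ℕ
size ε       = zero
size (Γ ▸ _) = suc (size Γ)

-- Out of scope indices get an irrelevant parameter, which has no readback.
names : Ctx → Subst
names ε             = λ _ → par irr zero (srt zero)
names (Γ ▸ (a , T)) = par a (size Γ) (inst (names Γ) T) ∷ names Γ

-- The shape of names Γ, with arbitrary types: all that is known about the right-hand side.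
data Naming : ℕ → Subst → Set where
  base : Naming zero (λ _ → par irr zero (srt zero))
  _▹_  : ∀ {m σ} → Naming m σ → ∀ a {A} → Naming (suc m) (par a m A ∷ σ)

names-naming : ∀ Γ → Naming (size Γ) (names Γ)
names-naming ε             = base
names-naming (Γ ▸ (a , T)) = names-naming Γ ▹ a

naming-par : ∀ {m σ} → Naming m σ → ∀ x → ∃₂ λ a l → ∃[ A ] σ x ≐ par a l A
naming-par base    x       = _ , _ , _ , refl
naming-par (N ▹ a) zero    = _ , _ , _ , refl
naming-par (N ▹ a) (suc x) = naming-par N x

naming-< : ∀ {m σ x l A} → Naming m σ → σ x ≐ par rel l A → l < m
naming-< base ()
naming-< {x = zero} (N ▹ rel) refl = n<1+n _
naming-< {x = zero} (N ▹ irr) ()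
naming-< {x = suc x} (N ▹ a) e     = m<n⇒m<1+n (naming-< N e)

-- The newest entry has a level above all earlier relevant ones, so a level determines its index,
-- even across two namings with different types. Hence equal readbacks `var l` come from the same
-- variable.
naming-injective : ∀ {m σ σ' x x' l A A'} → Naming m σ → Naming m σ' →
                   σ x ≐ par rel l A → σ' x' ≐ par rel l A' → x ≐ x'
naming-injective base base ()
naming-injective {x = zero}  {zero}   (N ▹ a) (N' ▹ a') e e'    = refl
naming-injective {x = zero}  {suc x'} (N ▹ a) (N' ▹ a') refl e' = ⊥-elim (<-irrefl refl (naming-< N' e'))
naming-injective {x = suc x} {zero}   (N ▹ a) (N' ▹ a') e refl  = ⊥-elim (<-irrefl refl (naming-< N e))
naming-injective {x = suc x} {suc x'} (N ▹ a) (N' ▹ a') e e'    = cong suc (naming-injective N N' e e')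

names-lookup : ∀ Γ {x l A} → names Γ x ≐ par rel l A → ∃[ T ] Γ ∋ x ∶ T × A ≐ inst (names Γ) T
names-lookup ε ()
names-lookup (Γ ▸ (rel , T)) {zero}  refl = wk T , here , sym (inst-wk T)
names-lookup (Γ ▸ (irr , T)) {zero}  ()
names-lookup (Γ ▸ (a , T))   {suc x} e    =
  let S , y , q = names-lookup Γ e in wk S , there y , trans q (sym (inst-wk S))

-- The fundamental theorem relates the type of each relevant variable to itself, and reflection then
-- does so for its parameter.
names-related : ∀ {Γ} → ⊢ Γ → ⟦ Γ ⟧ (names Γ) (names Γ)
names-related ctx-ε                       = tt
names-related (ctx-▸ {Γ} {rel} c (_ , d)) =
  let p = srt⇒≈ (related (fundamental d) (names-related c))
  in names-related c , p , fresh rel (size Γ) p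
names-related (ctx-▸ {a = irr} c _)       = names-related c

ty-ctx : ∀ {Γ t T} → Γ ⊢ t ∶ T → ⊢ Γ
ty-ctx (ty-srt c)    = c
ty-ctx (ty-pi d _)   = ty-ctx d
ty-ctx (ty-var c _)  = c
ty-ctx (ty-lam d _) with ctx-▸ c _ ← ty-ctx d = c
ty-ctx (ty-app d _)  = ty-ctx d
ty-ctx (ty-conv d _) = ty-ctx d

eq-ctx : ∀ {Γ t t' T} → Γ ⊢ t ≡ t' ∶ T → ⊢ Γ
eq-ctx (eq-β d _) with ctx-▸ c _ ← ty-ctx d = c
eq-ctx (eq-η d)       = ty-ctx d
eq-ctx (eq-refl d)    = ty-ctx d
eq-ctx (eq-sym d)     = eq-ctx d
eq-ctx (eq-trans d _) = eq-ctx d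
eq-ctx (eq-pi d _)    = eq-ctx d
eq-ctx (eq-lam d _ _) = eq-ctx d
eq-ctx (eq-app d _)   = eq-ctx d
eq-ctx (eq-conv d _)  = eq-ctx d

-- Reflection of evaluation from instances to syntax.

-- The graph of inst σ for a σ that maps variables to parameters.
data View (σ : Subst) : Tm → Exp → Set where
  srt : ∀ {k} → View σ (srt k) (srt k)
  pi  : ∀ {a i j U T} → View σ (pi a i j U T) (pi a i j (inst σ U) (inst (lift σ) T))
  var : ∀ {x a l A} → σ x ≐ par a l A → View σ (var x) (par a l A)
  lam : ∀ {a U t} → View σ (lam a U t) (lam a (inst σ U) (inst (lift σ) t))
  app : ∀ {a t u} → View σ (app a t u) (app a (inst σ t) (inst σ u))

view-≐ : ∀ {σ t s} → View σ t s → s ≐ inst σ t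
view-≐ srt     = refl
view-≐ pi      = refl
view-≐ (var e) = sym e
view-≐ lam     = refl
view-≐ app     = refl

module _ {m σ} (N : Naming m σ) where

  view : ∀ t → View σ t (inst σ t)
  view (srt k)        = srt
  view (pi a i j U T) = pi
  view (var x) with _ , _ , _ , e ← naming-par N x = subst (View σ (var x)) (sym e) (var e)
  view (lam a U t)    = lam
  view (app a t u)    = app

  neutral⁻¹ : ∀ {t n} → View σ t n → NeutralE n → Neutral t
  neutral⁻¹ (var _) _ = ne-var
  neutral⁻¹ (app {t = t}) (ne-app n) = ne-app (neutral⁻¹ (view t) n)

  whnf⁻¹ : ∀ {t a} → View σ t a → WhnfE a → Whnf t
  whnf⁻¹ srt _            = wh-srt
  whnf⁻¹ pi _             = wh-pi
  whnf⁻¹ (var _) _        = wh-ne ne-var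
  whnf⁻¹ lam _            = wh-lam
  whnf⁻¹ app (wh-ne n)    = wh-ne (neutral⁻¹ app n)

  mutual
    -- Variables become parameters, which are neutral, so instantiation creates no new redex and
    -- every evaluation step is already one of `t`.
    ⇘⁻¹ : ∀ {t s a} → View σ t s → s ⇘ a → ∃[ b ] t ↘ b × View σ b a
    ⇘⁻¹ v (ev-whnf w) = _ , ev-whnf (whnf⁻¹ v w) , v
    ⇘⁻¹ (app {t = t} {u}) (ev-app d e) =
      let _ , d' , v = ⇘⁻¹ (view t) d
          _ , e' , w = ·⇘⁻¹ u v e
      in _ , ev-app d' e' , w

    ·⇘⁻¹ : ∀ {⋆ f s a} u → View σ f s → s ·[ ⋆ ] inst σ u ⇘ a → ∃[ b ] f ·[ ⋆ ] u ↘ b × View σ b a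
    ·⇘⁻¹ u (lam {t = t}) (ap-β d) =
      let _ , d' , v = ⇘⁻¹ (subst (View σ (t [ u ])) (sym (inst-lift-[] σ t u)) (view (t [ u ]))) d
      in _ , ap-β d' , v
    ·⇘⁻¹ u v (ap-ne n) with refl ← view-≐ v = _ , ap-ne (neutral⁻¹ v n) , app

-- From a common readback to algorithmic equality.

mutual
  -- The right-hand naming is arbitrary because, under a binder, `Γ` grows by the left-hand domain
  -- while the right-hand body is opened with a parameter of its own domain.
  ty⇔-complete : ∀ Γ {σ T T' V} → Naming (size Γ) σ →
                 size Γ ⊢ inst (names Γ) T ⇓ty V → size Γ ⊢ inst σ T' ⇓ty V → Γ ⊢ T ⇔ty T'
  ty⇔-complete Γ {T = T} {T'} N (eval-ty d r) (eval-ty d' r') =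
    let _ , e  , v  = ⇘⁻¹ (names-naming Γ) (view (names-naming Γ) T) d
        _ , e' , v' = ⇘⁻¹ N (view N T') d'
    in ty⇔ e e' (ty↔-complete Γ N v v' r r')

  ty↔-complete : ∀ Γ {σ A A' B B' V} → Naming (size Γ) σ → View (names Γ) A B → View σ A' B' →
                 size Γ ⊢ B ↓ty V → size Γ ⊢ B' ↓ty V → Γ ⊢ A ↔ty A'
  ty↔-complete Γ N srt srt ↓ty-srt ↓ty-srt = ty↔-srt
  ty↔-complete Γ {σ} N (pi {a} {U = U} {T}) (pi {U = U'} {T'}) (↓ty-pi c d) (↓ty-pi c' d') =
    ty↔-pi (ty⇔-complete Γ {T = U} {U'} N c c')
           -- Readback at level `size Γ` opens the left-hand body with exactly the parameter that
           -- `names` assigns to the new variable.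
           (ty⇔-complete (Γ ▸ (a , U)) {T = T} {T'} (N ▹ a)
             (subst (λ S → _ ⊢ S ⇓ty _) (inst-lift-⟨⟩ (names Γ) T _) d)
             (subst (λ S → _ ⊢ S ⇓ty _) (inst-lift-⟨⟩ σ T' _) d'))
  ty↔-complete Γ N v v' (↓ty-ne d) (↓ty-ne d') =
    let _ , c , _ = ne⇔-complete Γ N v v' d d'
    in ty↔-ne (neutral⁻¹ (names-naming Γ) v (⇓ne-neutral d)) (neutral⁻¹ N v' (⇓ne-neutral d')) c

  -- Structural equality must output a syntactic type, so the type found by readback is recognised
  -- as an instance: parameters carry instances, and at an application the evaluation of the
  -- function type is reflected.
  ne⇔-complete : ∀ Γ {σ n n' s s' v A A'} → Naming (size Γ) σ → View (names Γ) n s → View σ n' s' →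
                 size Γ ⊢ s ⇓ne v ∶ A → size Γ ⊢ s' ⇓ne v ∶ A' →
                 ∃[ T ] Γ ⊢ n ⇔ne n' ∶ T × A ≐ inst (names Γ) T
  ne⇔-complete Γ N (var e) (var e') ⇓ne-par ⇓ne-par
    with refl ← naming-injective (names-naming Γ) N e e' =
    let T , x , q = names-lookup Γ e in T , ne⇔-var x , q
  ne⇔-complete Γ N (app {t = n} {u}) (app {t = n'} {u'}) (⇓ne-rel d e c) (⇓ne-rel d' _ c')
    with S , h , refl ← ne⇔-complete Γ N (view (names-naming Γ) n) (view N n') d d'
    with _ , f , pi {T = T} ← ⇘⁻¹ (names-naming Γ) (view (names-naming Γ) S) e =
    T [ u ] , ne⇔-app-rel (ne↔ h f) (tm⇔-complete Γ {t = u} {u'} N refl c c') , inst-lift-[] (names Γ) T u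
  ne⇔-complete Γ N (app {t = n} {u}) (app {t = n'}) (⇓ne-irr d e) (⇓ne-irr d' _)
    with S , h , refl ← ne⇔-complete Γ N (view (names-naming Γ) n) (view N n') d d'
    with _ , f , pi {T = T} ← ⇘⁻¹ (names-naming Γ) (view (names-naming Γ) S) e =
    T [ u ] , ne⇔-app-irr (ne↔ h f) , inst-lift-[] (names Γ) T u

  tm⇔-complete : ∀ Γ {σ t t' T A A' v} → Naming (size Γ) σ → A ≐ inst (names Γ) T →
                 size Γ ⊢ inst (names Γ) t ⇓tm v ∶ A → size Γ ⊢ inst σ t' ⇓tm v ∶ A' → Γ ⊢ t ⇔tm t' ∶ T
  tm⇔-complete Γ {t = t} {t'} {T} N refl (eval-tm d r) (eval-tm _ r') =
    let _ , e , w = ⇘⁻¹ (names-naming Γ) (view (names-naming Γ) T) d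
    in tm⇔ e (tm↔-complete Γ {t = t} {t'} N w r r')

  tm↔-complete : ∀ Γ {σ t t' A B B' v} → Naming (size Γ) σ → View (names Γ) A B →
                 size Γ ⊢ inst (names Γ) t ↓tm v ∶ B → size Γ ⊢ inst σ t' ↓tm v ∶ B' → Γ ⊢ t ↔tm t' ∶ A
  tm↔-complete Γ {t = t} {t'} N srt (↓tm-srt d) (↓tm-srt d') = tm↔-srt (ty⇔-complete Γ {T = t} {t'} N d d')
  tm↔-complete Γ {σ} {t} {t'} N (pi {a} {U = U} {T}) (↓tm-pi d) (↓tm-pi d') =
    tm↔-pi (tm⇔-complete (Γ ▸ (a , U)) {t = app a (wk t) (var zero)} {app a (wk t') (var zero)} (N ▹ a)
             (inst-lift-⟨⟩ (names Γ) T _)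
             (subst (λ s → _ ⊢ app a s _ ⇓tm _ ∶ _) (sym (inst-wk t)) d)
             (subst (λ s → _ ⊢ app a s _ ⇓tm _ ∶ _) (sym (inst-wk t')) d'))
  tm↔-complete Γ {t = t} {t'} N w (↓tm-ne n d r) (↓tm-ne _ d' r') =
    let _ , e  , v  = ⇘⁻¹ (names-naming Γ) (view (names-naming Γ) t) d
        _ , e' , v' = ⇘⁻¹ N (view N t') d'
        _ , c , _   = ne⇔-complete Γ N v v' r r'
    in tm↔-ne (neutral⁻¹ (names-naming Γ) w n) e e' c

theorem6p4 : (Γ : Ctx) (t t' T : Tm) →
    Γ ⊢ t ≡ t' ∶ T → Γ ⊢ t ⇔tm t' ∶ T
theorem6p4 Γ t t' T d =
  let p , r     = related (fundamental-eq d) (names-related (eq-ctx d))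
      -- `size Γ` is the first level that `names Γ` leaves free.
      _ , c , c' = reify p r (size Γ)
  in tm⇔-complete Γ (names-naming Γ) refl c c'
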